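{- For any given rooted tree $L$, the proportion of $n$-vertex rooted trees that have $L$ as a maximal limb approaches $1$ as $n\to\infty$.
   Context: Rooted trees are finite and are counted up to root-preserving isomorphism. For a rooted tree $T$ and a vertex $v$ of $T$, the maximal limb at $v$ is the rooted subtree of $T$ with root $v$ consisting of $v$ and all descendants of $v$. The tree $T$ has $L$ as a maximal limb if for some vertex $v$ of $T$ the maximal limb at $v$ is isomorphic to $L$ as a rooted tree. -}

module Defs where

open import Data.Fin using (Fin)
open import Data.Integer using (+_)
open import Data.List using (List; []; _∷_; length; lookup)
open import Data.Nat using (ℕ; suc; _+_; _≥_; NonZero)
open import Data.Product using (Σ-syntax; ∃-syntax; proj₁)
open import Data.Rational using (ℚ; 0ℚ; _/_; _-_; ∣_∣; _<_)
open import Function.Bundles using (_↔_; _⇔_; Inverse; Equivalence; mk⇔)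
open import Function.Construct.Composition using (_⇔-∘_)
open import Function.Properties.Inverse using (↔-refl; ↔-sym; ↔-trans)
open import Level using (0ℓ)
open import Relation.Binary.Bundles using (Setoid)
open import Relation.Binary.Core using (Rel)
import Relation.Binary.Construct.On as On
open import Relation.Binary.Construct.Closure.Symmetric using (SymClosure)
open import Relation.Binary.PropositionalEquality using (_≡_; refl; sym; trans; cong; subst₂; setoid)

-- The order in which the list presents the children carries no meaning: trees
-- are only ever compared up to the isomorphism _≅_ below, which forgets it.
data RootedTree : Set where
  node : List RootedTree → RootedTree

data Vertex : RootedTree → Set where
  root  : ∀ {t} → Vertex t
  below : ∀ {ts} (i : Fin (length ts)) → Vertex (lookup ts i) → Vertex (node ts)

-- The number of vertices.
mutual
  size : RootedTree → ℕ
  size (node ts) = suc (sizes ts)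

  sizes : List RootedTree → ℕ
  sizes []       = 0
  sizes (t ∷ ts) = size t + sizes ts

-- v ◁ w: v is the parent of w.
infix 4 _◁_
data _◁_ : ∀ {t} → Rel (Vertex t) 0ℓ where
  top    : ∀ {ts} (i : Fin (length ts)) → root {node ts} ◁ below i root
  inside : ∀ {ts} (i : Fin (length ts)) {v w : Vertex (lookup ts i)} →
           v ◁ w → below {ts} i v ◁ below i w

Adjacent : ∀ {t} → Rel (Vertex t) 0ℓ
Adjacent = SymClosure _◁_

-- Isomorphism of the underlying graphs taking root to root.
infix 4 _≅_
record _≅_ (s t : RootedTree) : Set where
  field
    bijection : Vertex s ↔ Vertex t

  open Inverse bijection public using (to; from; strictlyInverseˡ; strictlyInverseʳ)

  field
    to-root     : to root ≡ root
    to-adjacent : ∀ v w → Adjacent v w ⇔ Adjacent (to v) (to w)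

≅-refl : ∀ {t} → t ≅ t
≅-refl = record
  { bijection   = ↔-refl
  ; to-root     = refl
  ; to-adjacent = λ _ _ → mk⇔ (λ a → a) (λ a → a)
  }

≅-sym : ∀ {s t} → s ≅ t → t ≅ s
≅-sym {s} {t} f = record
  { bijection   = ↔-sym F.bijection
  ; to-root     = trans (cong F.from (sym F.to-root)) (F.strictlyInverseʳ root)
  ; to-adjacent = λ v w → mk⇔
      (λ a → Equivalence.from (F.to-adjacent (F.from v) (F.from w))
               (subst₂ Adjacent (sym (F.strictlyInverseˡ v)) (sym (F.strictlyInverseˡ w)) a))
      (λ a → subst₂ Adjacent (F.strictlyInverseˡ v) (F.strictlyInverseˡ w)
               (Equivalence.to (F.to-adjacent (F.from v) (F.from w)) a))
  }
  where module F = _≅_ f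

≅-trans : ∀ {s t u} → s ≅ t → t ≅ u → s ≅ u
≅-trans f g = record
  { bijection   = ↔-trans F.bijection G.bijection
  ; to-root     = trans (cong G.to F.to-root) G.to-root
  ; to-adjacent = λ v w → G.to-adjacent (F.to v) (F.to w) ⇔-∘ F.to-adjacent v w
  }
  where
  module F = _≅_ f
  module G = _≅_ g

≅-setoid : Setoid 0ℓ 0ℓ
≅-setoid = record
  { Carrier       = RootedTree
  ; _≈_           = _≅_
  ; isEquivalence = record { refl = ≅-refl ; sym = ≅-sym ; trans = ≅-trans }
  }

-- The maximal limb at v.
limb : ∀ {t} → Vertex t → RootedTree
limb {t} root    = t
limb (below i v) = limb v

HasMaximalLimb : RootedTree → RootedTree → Set
HasMaximalLimb L t = ∃[ v ] limb {t} v ≅ L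

-- Up to isomorphism there are exactly k rooted trees t with P t: the trees
-- satisfying P, with _≅_ as equality, are in bijection with Fin k.  For given P
-- there is at most one such k.
CountUpToIso : (RootedTree → Set) → ℕ → Set
CountUpToIso P k =
  Inverse (On.setoid ≅-setoid (proj₁ {A = RootedTree} {B = P})) (setoid (Fin k))

-- a n / b n → x as n → ∞; the quotient has to be defined only for large n.
QuotientTendsTo : (a b : ℕ → ℕ) → ℚ → Set
QuotientTendsTo a b x =
  ∀ (ε : ℚ) → 0ℚ < ε → ∃[ N ] ∀ n → n ≥ N →
  Σ[ b≢0 ∈ NonZero (b n) ] ∣ _/_ (+ a n) (b n) {{b≢0}} - x ∣ < ε

{-# OPTIONS --safe #-}

-- The trees of size n without the limb L are compared with all trees of size n
-- by two moves of bounded ambiguity.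
--
-- Shrinking: a tree t without L, of size at least 2|L| + 2, has a group of
-- siblings whose limbs have total size between s = 2|L| + 1 and 2s.  Replacing
-- the group by a chain ending in L, of the right length, gives a tree of size
-- n - |L| in which L occurs exactly once.  That occurrence locates the
-- replacement, and only boundedly many groups could have been there, so this
-- move is at most K-to-one with K depending on L only.
--
-- Growing: if the smaller tree has at least W non-isomorphic limbs, hanging a
-- copy of L from the root of each of them gives W pairs (tree, limb); the tree
-- of size n so obtained has at most two copies of L, so it comes from at most
-- two pairs.
--
-- A tree with fewer than W limbs up to isomorphism is determined by a W × W
-- table of multiplicities, so there are only polynomially many of them, while
-- the number of all trees at least doubles when the size grows by 3.  Hence for
-- large n at most a proportion 3K / W of the trees avoid L, for every W.
module Submission where

open import Defs
open import Data.Fin using (Fin; zero; suc; punchIn)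
open import Data.Fin.Permutation as FinPerm using (_⟨$⟩ʳ_)
open import Data.Fin.Properties using (injective⇒≤)
open import Data.Integer as ℤ using (-[1+_]; +[1+_])
import Data.Integer.Properties as ℤₚ
open import Data.List using (List; []; _∷_; _++_; length; lookup; map; filter; tabulate;
  take; replicate; upTo; concatMap; deduplicate; cartesianProductWith)
open import Data.List.Properties using (length-map; length-++; length-take; length-upTo;
  length-replicate; take-all; tabulate-lookup; ++-identityʳ)
open import Data.List.Membership.Propositional using (find; lose) renaming (_∈_ to _∈ₚ_)
open import Data.List.Membership.Propositional.Properties
  using (∈-map⁺; ∈-++⁺ˡ; ∈-++⁺ʳ; ∈-filter⁺; ∈-filter⁻; ∈-upTo⁺; ∈-cartesianProductWith⁺)
import Data.List.Membership.Setoid as SetoidMembership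
import Data.List.Membership.Setoid.Properties as SetoidMembershipₚ
import Data.List.Relation.Binary.Permutation.Homogeneous as Perm
import Data.List.Relation.Binary.Permutation.Setoid as SetoidPerm
import Data.List.Relation.Binary.Permutation.Setoid.Properties as SetoidPermₚ
open import Data.List.Relation.Binary.Pointwise using (Pointwise; []; _∷_; Pointwise-length)
open import Data.List.Relation.Unary.All as All using (All; []; _∷_)
import Data.List.Relation.Unary.All.Properties as Allₚ
open import Data.List.Relation.Unary.AllPairs as AllPairs using ([]; _∷_)
import Data.List.Relation.Unary.AllPairs.Properties as AllPairsₚ
open import Data.List.Relation.Unary.Any as Any using (Any; here; there)
import Data.List.Relation.Unary.Any.Properties as Anyₚ
open import Data.List.Relation.Unary.Unique.DecSetoid.Properties using (deduplicate-!)
import Data.List.Relation.Unary.Unique.Setoid as SetoidUnique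
import Data.List.Relation.Unary.Unique.Setoid.Properties as SetoidUniqueₚ
open import Data.Maybe using (Maybe; just; nothing; fromMaybe)
open import Data.Maybe.Relation.Binary.Pointwise as Maybe using (just; nothing)
open import Data.Nat
open import Data.Nat.DivMod using (m≡m%n+[m/n]*n; m%n<n; m*n/n≡m; /-monoˡ-≤)
open import Data.Nat.Properties
open import Data.Nat.Tactic.RingSolver using (solve-∀)
open import Data.Product using (Σ; Σ-syntax; ∃-syntax; _×_; _,_; proj₁; proj₂)
open import Data.Product.Function.Dependent.Propositional using (Σ-↔)
open import Data.Product.Relation.Binary.Pointwise.NonDependent using (×-setoid)
open import Data.Rational as ℚ using (ℚ; mkℚ; 0ℚ; 1ℚ; ↧ₙ_; toℚᵘ)
import Data.Rational.Properties as ℚₚ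
open import Data.Rational.Unnormalised as ℚᵘ using (ℚᵘ; mkℚᵘ; *<*; *≡*)
import Data.Rational.Unnormalised.Properties as ℚᵘₚ
open import Data.Sum using (_⊎_; inj₁; inj₂)
open import Function using (_∘_)
open import Function.Bundles using (_↔_; Inverse; Equivalence; mk⇔; mk↔ₛ′)
open import Level using (0ℓ)
open import Relation.Binary.Bundles using (Setoid; DecSetoid)
open import Relation.Binary.Construct.Closure.Symmetric using (fwd; bwd)
open import Relation.Binary.Core using (Rel)
open import Relation.Binary.PropositionalEquality
open import Relation.Nullary using (Dec; yes; no; ¬_; ¬?; contradiction)
open import Relation.Nullary.Decidable using (map′)
open import Relation.Unary using (Decidable)

-- Isomorphism as recursive permutation of children

Forest : Set
Forest = List RootedTree

infix 4 _~_ _~*_ _~?_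
-- The inductive counterpart of `_≅_`: it admits induction on derivations and a decision procedure,
-- and is shown below to agree with `_≅_`.
data _~_ : Rel RootedTree 0ℓ where
  node : ∀ {ts us} → Perm.Permutation _~_ ts us → node ts ~ node us

_~*_ : Rel Forest 0ℓ
_~*_ = Perm.Permutation _~_

mutual
  ~-refl : ∀ {t} → t ~ t
  ~-refl {node ts} = node (Perm.refl (~-refls ts))

  ~-refls : ∀ ts → Pointwise _~_ ts ts
  ~-refls []       = []
  ~-refls (t ∷ ts) = ~-refl ∷ ~-refls ts

~*-refl : ∀ {ts} → ts ~* ts
~*-refl {ts} = Perm.refl (~-refls ts)

-- Invariance under `_~_` reduces to these five cases. `Perm.swap` may also change the two entries;
-- it is split into changing them and then exchanging them, so that `swap-case` only sees a pure
-- exchange.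
module ~-Induction
  (P  : Rel RootedTree 0ℓ) (P* : Rel Forest 0ℓ)
  (node-case : ∀ {ts us} → P* ts us → P (node ts) (node us))
  (nil-case  : P* [] [])
  (cons-case : ∀ {t u ts us} → P t u → P* ts us → P* (t ∷ ts) (u ∷ us))
  (swap-case : ∀ t u ts → P* (t ∷ u ∷ ts) (u ∷ t ∷ ts))
  (trans-case : ∀ {ts us vs} → P* ts us → P* us vs → P* ts vs)
  where

  mutual
    ind : ∀ {t u} → t ~ u → P t u
    ind (node p) = node-case (ind* p)

    ind* : ∀ {ts us} → ts ~* us → P* ts us
    ind* (Perm.refl p)     = ind-pointwise p
    ind* (Perm.prep e p)   = cons-case (ind e) (ind* p)
    ind* (Perm.swap e f p) =
      trans-case (cons-case (ind e) (cons-case (ind f) (ind* p))) (swap-case _ _ _)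
    ind* (Perm.trans p q)  = trans-case (ind* p) (ind* q)

    ind-pointwise : ∀ {ts us} → Pointwise _~_ ts us → P* ts us
    ind-pointwise []       = nil-case
    ind-pointwise (e ∷ es) = cons-case (ind e) (ind-pointwise es)

~-sym : ∀ {t u} → t ~ u → u ~ t
~-sym = ~-Induction.ind (λ t u → u ~ t) (λ ts us → us ~* ts)
  node (Perm.refl []) Perm.prep (λ _ _ _ → Perm.swap ~-refl ~-refl ~*-refl)
  (λ p q → Perm.trans q p)

~-trans : ∀ {t u v} → t ~ u → u ~ v → t ~ v
~-trans (node p) (node q) = node (Perm.trans p q)

~-setoid : Setoid 0ℓ 0ℓ
~-setoid = record
  { Carrier       = RootedTree
  ; _≈_           = _~_
  ; isEquivalence = record { refl = ~-refl ; sym = ~-sym ; trans = ~-trans }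
  }

open SetoidMembership ~-setoid using (_∈_)
open SetoidUnique ~-setoid using (Unique)
open SetoidPerm ~-setoid using (↭-trans; ↭-sym; ↭-swap)
open SetoidPermₚ ~-setoid using (drop-∷; ∈-resp-↭; xs↭ys⇒|xs|≡|ys|; ++⁺ˡ; shift)

-- Isomorphism is decidable

extract : ∀ {t} {us : Forest} (t∈us : t ∈ us) → us ~* t ∷ (us Any.─ t∈us)
extract (here t~u)  = Perm.prep (~-sym t~u) ~*-refl
extract (there t∈us) = ↭-trans (Perm.prep ~-refl (extract t∈us)) (↭-swap _ _ ~*-refl)

mutual
  _~?_ : ∀ t u → Dec (t ~ u)
  node ts ~? node us = map′ node (λ { (node p) → p }) (ts ~*? us)

  -- Greedy matching needs no backtracking: any entry of `us` equivalent to `t` may be paired with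
  -- it, because permutations allow cancelling a common head (`drop-∷`).
  _~*?_ : ∀ ts us → Dec (ts ~* us)
  []       ~*? []       = yes ~*-refl
  []       ~*? (u ∷ us) = no λ p → contradiction (xs↭ys⇒|xs|≡|ys| p) λ ()
  (t ∷ ts) ~*? us with Any.any? (t ~?_) us
  ... | no  t∉us = no λ p → t∉us (∈-resp-↭ p (here ~-refl))
  ... | yes t∈us = map′
    (λ p → ↭-trans (Perm.prep ~-refl p) (↭-sym (extract t∈us)))
    (λ p → drop-∷ (↭-trans p (extract t∈us)))
    (ts ~*? (us Any.─ t∈us))

-- Recursive isomorphism and graph isomorphism agree

parent-unique : ∀ {t} {u v w : Vertex t} → u ◁ w → v ◁ w → u ≡ v
parent-unique (top i)      (top .i)      = refl
parent-unique (inside i p) (inside .i q) = cong (below i) (parent-unique p q)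

root-or-child : ∀ {t} (w : Vertex t) → w ≡ root ⊎ ∃[ v ] v ◁ w
root-or-child root        = inj₁ refl
root-or-child (below i w) with root-or-child w
... | inj₁ refl      = inj₂ (root , top i)
... | inj₂ (v , v◁w) = inj₂ (below i v , inside i v◁w)

depth : ∀ {t} → Vertex t → ℕ
depth root        = 0
depth (below i v) = suc (depth v)

depth-◁ : ∀ {t} {v w : Vertex t} → v ◁ w → depth w ≡ suc (depth v)
depth-◁ (top i)      = refl
depth-◁ (inside i p) = cong suc (depth-◁ p)

root-orphan : ∀ {t} {v : Vertex t} → ¬ v ◁ root
root-orphan ()

◁-asym : ∀ {t} {v w : Vertex t} → v ◁ w → ¬ w ◁ v
◁-asym (inside i p) (inside .i q) = ◁-asym p q

module _ {s t} (f : Vertex s ↔ Vertex t) (f-root : Inverse.to f root ≡ root)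
         (f-◁ : ∀ {v w} → v ◁ w → Inverse.to f v ◁ Inverse.to f w) where
  open Inverse f

  to-injective : ∀ {v w} → to v ≡ to w → v ≡ w
  to-injective {v} {w} eq = trans (sym (strictlyInverseʳ v)) (trans (cong from eq) (strictlyInverseʳ w))

  -- The parent of `w` is sent to a parent of `to w`. Since parents are unique and `to` is
  -- injective, that parent is `v`.
  reflects-◁ : ∀ {v w} → to v ◁ to w → v ◁ w
  reflects-◁ {v} {w} q with root-or-child w
  ... | inj₁ refl      = contradiction (subst (to v ◁_) f-root q) root-orphan
  ... | inj₂ (p , p◁w) = subst (_◁ w) (to-injective (parent-unique (f-◁ p◁w) q)) p◁w

  ◁-preserving⇒≅ : s ≅ t
  ◁-preserving⇒≅ = record
    { bijection   = f
    ; to-root     = f-root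
    ; to-adjacent = λ v w → mk⇔
        (λ { (fwd p) → fwd (f-◁ p) ; (bwd p) → bwd (f-◁ p) })
        (λ { (fwd p) → fwd (reflects-◁ p) ; (bwd p) → bwd (reflects-◁ p) })
    }

-- Adjacency could only reverse an edge. If `to w` were the parent of `to v`, then by induction on
-- depth the parent of `v` would also be sent to the parent of `to v`, hence would be `w`,
-- contradicting `v ◁ w`. At the root a reversed edge would give the root a parent.
◁-preserved : ∀ {s t} (f : s ≅ t) {v w} → v ◁ w → _≅_.to f v ◁ _≅_.to f w
◁-preserved {s} {t} f = go _ refl
  where
  open _≅_ f

  go : ∀ d {v w} → d ≡ depth v → v ◁ w → to v ◁ to w
  go d {v} {w} d≡ v◁w with Equivalence.to (to-adjacent v w) (fwd v◁w)
  ... | fwd q = q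
  ... | bwd q with root-or-child v
  ...   | inj₁ refl = contradiction (subst (to w ◁_) to-root q) root-orphan
  ...   | inj₂ (p , p◁v) with d
  ...     | zero  = contradiction (trans d≡ (depth-◁ p◁v)) λ ()
  ...     | suc d = contradiction v◁w (◁-asym (subst (_◁ v) p≡w p◁v))
    where
    p≡w : p ≡ w
    p≡w = trans (sym (strictlyInverseʳ p))
            (trans (cong from (parent-unique (go d (suc-injective (trans d≡ (depth-◁ p◁v))) p◁v) q))
              (strictlyInverseʳ w))

-- The vertices of `node ts` other than its root, as a Σ-type, so that `Σ-↔` assembles a bijection
-- from a permutation of the children and bijections between their vertex sets.
ForestVertex : Forest → Set
ForestVertex ts = Σ[ i ∈ Fin (length ts) ] Vertex (lookup ts i)

graft : ∀ {ts us} → (ForestVertex ts → ForestVertex us) → Vertex (node ts) → Vertex (node us)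
graft f root        = root
graft f (below i v) = let (j , w) = f (i , v) in below j w

graft-inverse : ∀ {ts us} (f : ForestVertex ts → ForestVertex us) (g : ForestVertex us → ForestVertex ts) →
                (∀ v → f (g v) ≡ v) → ∀ v → graft f (graft {us} {ts} g v) ≡ v
graft-inverse f g inv root        = refl
graft-inverse f g inv (below i v) = cong (λ (j , w) → below j w) (inv (i , v))

module _ {ts us} (π : FinPerm.Permutation (length ts) (length us))
         (isos : ∀ i → lookup ts i ≅ lookup us (π ⟨$⟩ʳ i)) where

  private
    forest-bijection : ForestVertex ts ↔ ForestVertex us
    forest-bijection = Σ-↔ π (λ {i} → _≅_.bijection (isos i))

    module F = Inverse forest-bijection

    tree-bijection : Vertex (node ts) ↔ Vertex (node us)
    tree-bijection = mk↔ₛ′ (graft F.to) (graft F.from)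
      (graft-inverse F.to F.from F.strictlyInverseˡ)
      (graft-inverse F.from F.to F.strictlyInverseʳ)

    tree-◁ : ∀ {v w} → v ◁ w → Inverse.to tree-bijection v ◁ Inverse.to tree-bijection w
    tree-◁ (top i)      = subst (λ v → root ◁ below _ v) (sym (_≅_.to-root (isos i))) (top _)
    tree-◁ (inside i p) = inside _ (◁-preserved (isos i) p)

  node-≅ : node ts ≅ node us
  node-≅ = ◁-preserving⇒≅ tree-bijection refl tree-◁

Matching : Rel RootedTree 0ℓ → Rel Forest 0ℓ
Matching R ts us = Σ[ π ∈ FinPerm.Permutation (length ts) (length us) ]
                     ∀ i → R (lookup ts i) (lookup us (π ⟨$⟩ʳ i))

~⇒≅ : ∀ {t u} → t ~ u → t ≅ u
~⇒≅ = ~-Induction.ind _≅_ (Matching _≅_)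
  (λ (π , isos) → node-≅ π isos)
  (FinPerm.id , λ ())
  (λ e (π , isos) → FinPerm.lift₀ π , λ { zero → e ; (suc i) → isos i })
  (λ t u ts → FinPerm.swap FinPerm.id ,
    λ { zero → ≅-refl ; (suc zero) → ≅-refl ; (suc (suc i)) → ≅-refl })
  (λ (π , isos) (ρ , isos′) → π FinPerm.∘ₚ ρ , λ i → ≅-trans (isos i) (isos′ _))

below-injective : ∀ {ts : Forest} {i} {v w : Vertex (lookup ts i)} → below {ts} i v ≡ below i w → v ≡ w
below-injective refl = refl

inside⁻¹ : ∀ {ts : Forest} {i} {v w : Vertex (lookup ts i)} → below {ts} i v ◁ below i w → v ◁ w
inside⁻¹ (inside _ p) = p

Restricts : ∀ {ts us} → (Vertex (node ts) → Vertex (node us)) →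
            Fin (length ts) → Fin (length us) → Set
Restricts f i j = ∀ v → ∃[ w ] f (below i v) ≡ below j w

-- Such a map commutes with taking parents, so it sends the limb at a child of
-- the root into a limb at a child of the root.
restricts : ∀ {ts us} (f : Vertex (node ts) → Vertex (node us)) →
            (∀ {v w} → v ◁ w → f v ◁ f w) →
            ∀ {i j} → f (below i root) ≡ below j root → Restricts f i j
restricts {ts} {us} f f-◁ {i} {j} eq v = go _ v refl
  where
  child : ∀ {x y : Vertex (node us)} → (∃[ w ] x ≡ below j w) → x ◁ y → ∃[ w ] y ≡ below j w
  child (_ , refl) (inside _ _) = _ , refl

  go : ∀ d v → d ≡ depth v → ∃[ w ] f (below i v) ≡ below j w
  go d v d≡ with root-or-child v
  ... | inj₁ refl = root , eq
  ... | inj₂ (p , p◁v) with d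
  ...   | zero  = contradiction (trans d≡ (depth-◁ p◁v)) λ ()
  ...   | suc d = child (go d p (suc-injective (trans d≡ (depth-◁ p◁v)))) (f-◁ (inside i p◁v))

module _ {ts us} (f : node ts ≅ node us) where
  private
    module F = _≅_ f

    f⁻¹-◁ : ∀ {v w} → v ◁ w → F.from v ◁ F.from w
    f⁻¹-◁ = ◁-preserved (≅-sym f)

  restrict-≅ : ∀ {i j} → F.to (below i root) ≡ below j root → lookup ts i ≅ lookup us j
  restrict-≅ {i} {j} eq = ◁-preserving⇒≅
    (mk↔ₛ′ (proj₁ ∘ down) (proj₁ ∘ up)
      (λ w → below-injective (trans (sym (proj₂ (down _)))
               (trans (cong F.to (sym (proj₂ (up w)))) (F.strictlyInverseˡ _))))
      (λ v → below-injective (trans (sym (proj₂ (up _)))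
               (trans (cong F.from (sym (proj₂ (down v)))) (F.strictlyInverseʳ _)))))
    (below-injective (trans (sym (proj₂ (down root))) eq))
    (λ {v} {w} p → inside⁻¹ (subst₂ _◁_ (proj₂ (down v)) (proj₂ (down w)) (◁-preserved f (inside i p))))
    where
    down : Restricts F.to i j
    down = restricts F.to (◁-preserved f) eq

    up : Restricts F.from j i
    up = restricts F.from f⁻¹-◁ (trans (cong F.from (sym eq)) (F.strictlyInverseʳ _))

  private
    child-of-root : ∀ {ts : Forest} {v : Vertex (node ts)} → root ◁ v → ∃[ i ] v ≡ below i root
    child-of-root (top i) = i , refl

    onChild : ∀ i → ∃[ j ] F.to (below i root) ≡ below j root
    onChild i = child-of-root (subst (_◁ F.to (below i root)) F.to-root (◁-preserved f (top i)))

    onChild⁻¹ : ∀ j → ∃[ i ] F.from (below j root) ≡ below i root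
    onChild⁻¹ j = child-of-root (subst (_◁ F.from (below j root))
      (trans (cong F.from (sym F.to-root)) (F.strictlyInverseʳ root)) (f⁻¹-◁ (top j)))

    below-index : ∀ {ts : Forest} {i j} → below {ts} i root ≡ below j root → i ≡ j
    below-index refl = refl

  ≅⇒matching : Matching _≅_ ts us
  ≅⇒matching = FinPerm.permutation (proj₁ ∘ onChild) (proj₁ ∘ onChild⁻¹)
    (λ j → below-index (trans (sym (proj₂ (onChild _)))
             (trans (cong F.to (sym (proj₂ (onChild⁻¹ j)))) (F.strictlyInverseˡ _))))
    (λ i → below-index (trans (sym (proj₂ (onChild⁻¹ _)))
             (trans (cong F.from (sym (proj₂ (onChild i)))) (F.strictlyInverseʳ _))))
    , λ i → restrict-≅ (proj₂ (onChild i))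

tabulate-punchIn : ∀ {n} (g : Fin (suc n) → RootedTree) j → tabulate g ~* g j ∷ tabulate (g ∘ punchIn j)
tabulate-punchIn g zero = ~*-refl
tabulate-punchIn {suc n} g (suc j) =
  ↭-trans (Perm.prep ~-refl (tabulate-punchIn (g ∘ suc) j)) (↭-swap _ _ ~*-refl)

-- Induction on the number of entries: the image of `zero` is brought to the front of `tabulate g`,
-- and `FinPerm.remove` deletes the matched pair from the permutation.
permuted-tabulate : ∀ {m n} (π : FinPerm.Permutation m n) (f : Fin m → RootedTree) (g : Fin n → RootedTree) →
                    (∀ i → f i ~ g (π ⟨$⟩ʳ i)) → tabulate f ~* tabulate g
permuted-tabulate {zero}  {zero}  π f g f~g = ~*-refl
permuted-tabulate {zero}  {suc n} π f g f~g = contradiction (FinPerm.↔⇒≡ π) λ ()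
permuted-tabulate {suc m} {zero}  π f g f~g = contradiction (FinPerm.↔⇒≡ π) λ ()
permuted-tabulate {suc m} {suc n} π f g f~g = ↭-trans
  (Perm.prep (f~g zero)
    (permuted-tabulate (FinPerm.remove zero π) (f ∘ suc) (g ∘ punchIn (π ⟨$⟩ʳ zero))
      λ i → subst (λ k → f (suc i) ~ g k) (FinPerm.punchIn-permute π zero i) (f~g (suc i))))
  (↭-sym (tabulate-punchIn g (π ⟨$⟩ʳ zero)))

matching⇒~* : ∀ {ts us} → Matching _~_ ts us → ts ~* us
matching⇒~* {ts} {us} (π , rel) =
  subst₂ _~*_ (tabulate-lookup ts) (tabulate-lookup us) (permuted-tabulate π (lookup ts) (lookup us) rel)

mutual
  ≅⇒~ : ∀ t u → t ≅ u → t ~ u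
  ≅⇒~ (node ts) (node us) f =
    node (matching⇒~* (proj₁ (≅⇒matching f) , λ i → ≅⇒~-lookup ts i _ (proj₂ (≅⇒matching f) i)))

  ≅⇒~-lookup : ∀ ts i u → lookup ts i ≅ u → lookup ts i ~ u
  ≅⇒~-lookup (t ∷ ts) zero    u f = ≅⇒~ t u f
  ≅⇒~-lookup (t ∷ ts) (suc i) u f = ≅⇒~-lookup ts i u f

-- Counting up to a setoid equality

module _ (S : Setoid 0ℓ 0ℓ) where
  open Setoid S renaming (refl to ≈-refl; sym to ≈-sym; trans to ≈-trans)
  open SetoidUnique S using () renaming (Unique to Uniqueₛ)
  open SetoidMembership S using () renaming (_∈_ to _∈ₛ_)

  lookup-≉ : ∀ {x xs} → All (λ y → ¬ x ≈ y) xs → ∀ j → ¬ x ≈ lookup xs j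
  lookup-≉ (x≉y ∷ _)  zero    = x≉y
  lookup-≉ (_ ∷ x≉xs) (suc j) = lookup-≉ x≉xs j

  unique⇒lookup-injective : ∀ {xs} → Uniqueₛ xs → ∀ i j → lookup xs i ≈ lookup xs j → i ≡ j
  unique⇒lookup-injective (_ ∷ _)  zero    zero    _ = refl
  unique⇒lookup-injective (x≉ ∷ _) zero    (suc j) e = contradiction e (lookup-≉ x≉ j)
  unique⇒lookup-injective (x≉ ∷ _) (suc i) zero    e = contradiction (≈-sym e) (lookup-≉ x≉ i)
  unique⇒lookup-injective (_ ∷ xs!) (suc i) (suc j) e = cong suc (unique⇒lookup-injective xs! i j e)

  -- The pigeonhole principle behind the bounds below. An injection is expressed as an inclusion
  -- into a list that may contain repetitions, so only the smaller list has to be free of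
  -- duplicates.
  unique-⊆⇒length-≤ : ∀ {xs ys} → Uniqueₛ xs → (∀ {x} → x ∈ₛ xs → x ∈ₛ ys) → length xs ≤ length ys
  unique-⊆⇒length-≤ {xs} {ys} xs! xs⊆ys = injective⇒≤ {f = λ i → Any.index (position i)}
    λ {i} {j} eq → unique⇒lookup-injective xs! i j
      (SetoidMembershipₚ.index-injective S (position i) (position j) eq)
    where
    position : ∀ i → lookup xs i ∈ₛ ys
    position i = xs⊆ys (SetoidMembershipₚ.∈-lookup S xs i)

countUpToIso : ∀ {P : RootedTree → Set} {xs} → Unique xs → (∀ i → P (lookup xs i)) →
               (∀ t → P t → t ∈ xs) → CountUpToIso P (length xs)
countUpToIso {P} {xs} xs! sound complete = record
  { to        = to
  ; from      = λ i → lookup xs i , sound i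
  ; to-cong   = λ {x} {y} x≅y → unique⇒lookup-injective ~-setoid xs! _ _
                  (~-trans (~-sym (lookup-to x)) (~-trans (≅⇒~ _ _ x≅y) (lookup-to y)))
  ; from-cong = λ { refl → ≅-refl }
  ; inverse   = (λ {i} {x} x≅ → unique⇒lookup-injective ~-setoid xs! _ _
                  (~-trans (~-sym (lookup-to x)) (≅⇒~ _ _ x≅)))
              , (λ { {x} refl → ~⇒≅ (~-sym (lookup-to x)) })
  }
  where
  to : Σ RootedTree P → Fin (length xs)
  to (t , p) = Any.index (complete t p)

  lookup-to : ∀ x → proj₁ x ~ lookup xs (to x)
  lookup-to (t , p) = Anyₚ.lookup-index (complete t p)

-- Occurrences of a limb

indicator : {P : Set} → Dec P → ℕ
indicator (yes _) = 1
indicator (no  _) = 0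

indicator-cong : ∀ {P Q : Set} (p? : Dec P) (q? : Dec Q) → (P → Q) → (Q → P) → indicator p? ≡ indicator q?
indicator-cong (yes _) (yes _) _ _ = refl
indicator-cong (no  _) (no  _) _ _ = refl
indicator-cong (yes p) (no ¬q) f _ = contradiction (f p) ¬q
indicator-cong (no ¬p) (yes q) _ g = contradiction (g q) ¬p

indicator-no : ∀ {P : Set} (p? : Dec P) → ¬ P → indicator p? ≡ 0
indicator-no (yes p) ¬p = contradiction p ¬p
indicator-no (no  _) _  = refl

mutual
  -- A count rather than a predicate, because it bounds in how many ways a move can be undone.
  occ : RootedTree → RootedTree → ℕ
  occ h (node ts) = indicator (node ts ~? h) + occs h ts

  occs : RootedTree → Forest → ℕ
  occs h []       = 0
  occs h (t ∷ ts) = occ h t + occs h ts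

+-exchange : ∀ a b c → a + (b + c) ≡ b + (a + c)
+-exchange a b c = trans (sym (+-assoc a b c)) (trans (cong (_+ c) (+-comm a b)) (+-assoc b a c))

size-resp-~ : ∀ {t u} → t ~ u → size t ≡ size u
size-resp-~ = ~-Induction.ind (λ t u → size t ≡ size u) (λ ts us → sizes ts ≡ sizes us)
  (cong suc) refl (cong₂ _+_) (λ t u ts → +-exchange (size t) (size u) (sizes ts)) trans

occ-resp-~ : ∀ h {t u} → t ~ u → occ h t ≡ occ h u
occ-resp-~ h p = proj₂ (~-Induction.ind
  (λ t u → t ~ u × occ h t ≡ occ h u) (λ ts us → ts ~* us × occs h ts ≡ occs h us)
  (λ {ts} {us} (q , e) → node q , cong₂ _+_
    (indicator-cong (node ts ~? h) (node us ~? h) (~-trans (~-sym (node q))) (~-trans (node q))) e)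
  (~*-refl , refl)
  (λ (q , e) (qs , es) → Perm.prep q qs , cong₂ _+_ e es)
  (λ t u ts → Perm.swap ~-refl ~-refl ~*-refl , +-exchange (occ h t) (occ h u) (occs h ts))
  (λ (p , e) (q , f) → Perm.trans p q , trans e f) p)

size-positive : ∀ t → 0 < size t
size-positive (node _) = z<s

mutual
  occ-smaller : ∀ h t → size t < size h → occ h t ≡ 0
  occ-smaller h (node ts) t<h = cong₂ _+_
    (indicator-no (node ts ~? h) λ e → <⇒≢ t<h (size-resp-~ e)) (occs-smaller h ts (<-trans (n<1+n _) t<h))

  occs-smaller : ∀ h ts → sizes ts < size h → occs h ts ≡ 0
  occs-smaller h []       _ = refl
  occs-smaller h (t ∷ ts) p = cong₂ _+_ (occ-smaller h t (≤-<-trans (m≤m+n _ _) p))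
                                        (occs-smaller h ts (≤-<-trans (m≤n+m _ (size t)) p))

occ-self : ∀ h → occ h h ≡ 1
occ-self h@(node ts) with node ts ~? h
... | yes _ = cong suc (occs-smaller h ts ≤-refl)
... | no ¬e = contradiction ~-refl ¬e

occ-larger : ∀ h ts → size h < size (node ts) → occ h (node ts) ≡ occs h ts
occ-larger h ts h<t = cong (_+ occs h ts) (indicator-no (node ts ~? h) λ e → >⇒≢ h<t (size-resp-~ e))

occs≤occ : ∀ h ts → occs h ts ≤ occ h (node ts)
occs≤occ h ts = m≤n+m _ _

occs-lookup : ∀ h ts i → occ h (lookup ts i) ≤ occs h ts
occs-lookup h (t ∷ ts) zero    = m≤m+n _ _
occs-lookup h (t ∷ ts) (suc i) = ≤-trans (occs-lookup h ts i) (m≤n+m _ (occ h t))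

occ-limb : ∀ h {t} (v : Vertex t) → occ h (limb v) ≤ occ h t
occ-limb h root = ≤-refl
occ-limb h (below {ts} i v) = ≤-trans (occ-limb h v) (≤-trans (occs-lookup h ts i) (occs≤occ h ts))

limb⇒occ : ∀ {h t} → HasMaximalLimb h t → 0 < occ h t
limb⇒occ {h} (v , e) = ≤-trans (≤-reflexive (sym (trans (occ-resp-~ h (≅⇒~ _ _ e)) (occ-self h)))) (occ-limb h v)

mutual
  occ⇒limb : ∀ {h} t → 0 < occ h t → HasMaximalLimb h t
  occ⇒limb {h} (node ts) p with node ts ~? h
  ... | yes e = root , ~⇒≅ e
  ... | no  _ = let i , v , e = occs⇒limb ts p in below i v , e

  occs⇒limb : ∀ {h} ts → 0 < occs h ts → ∃[ i ] HasMaximalLimb h (lookup ts i)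
  occs⇒limb {h} (t ∷ ts) p with occ h t in eq
  ... | suc _ = zero , occ⇒limb t (subst (0 <_) (sym eq) z<s)
  ... | zero  = let i , l = occs⇒limb ts p in suc i , l

-- Enumeration

module _ {A : Set} where

  lists≤ : List A → ℕ → List (List A)
  lists≤ xs zero    = [] ∷ []
  lists≤ xs (suc k) = [] ∷ cartesianProductWith _∷_ xs (lists≤ xs k)

  ∈-lists≤ : ∀ {xs zs} k → length zs ≤ k → All (_∈ₚ xs) zs → zs ∈ₚ lists≤ xs k
  ∈-lists≤ zero    z≤n       []       = here refl
  ∈-lists≤ (suc k) z≤n       []       = here refl
  ∈-lists≤ (suc k) (s≤s len) (p ∷ ps) = there (∈-cartesianProductWith⁺ _∷_ p (∈-lists≤ k len ps))

-- The parameter bounds both the height and the number of children, which keeps the recursion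
-- structural. Larger trees are listed as well; `representatives` filters by size.
trees≤ : ℕ → List RootedTree
trees≤ zero    = []
trees≤ (suc d) = map node (lists≤ (trees≤ d) d)

length≤sizes : ∀ ts → length ts ≤ sizes ts
length≤sizes []       = z≤n
length≤sizes (t ∷ ts) = +-mono-≤ (size-positive t) (length≤sizes ts)

mutual
  ∈-trees≤ : ∀ d t → size t ≤ d → t ∈ₚ trees≤ d
  ∈-trees≤ (suc d) (node ts) (s≤s p) =
    ∈-map⁺ node (∈-lists≤ d (≤-trans (length≤sizes ts) p) (all-∈-trees≤ d ts p))

  all-∈-trees≤ : ∀ d ts → sizes ts ≤ d → All (_∈ₚ trees≤ d) ts
  all-∈-trees≤ d []       p = []
  all-∈-trees≤ d (t ∷ ts) p =
    ∈-trees≤ d t (≤-trans (m≤m+n _ _) p) ∷ all-∈-trees≤ d ts (≤-trans (m≤n+m _ (size t)) p)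

forests≤ : ℕ → List Forest
forests≤ d = lists≤ (trees≤ d) d

∈-forests≤ : ∀ d ts → sizes ts ≤ d → ts ∈ₚ forests≤ d
∈-forests≤ d ts p = ∈-lists≤ d (≤-trans (length≤sizes ts) p) (all-∈-trees≤ d ts p)

~-decSetoid : DecSetoid 0ℓ 0ℓ
~-decSetoid = record
  { Carrier = RootedTree ; _≈_ = _~_
  ; isDecEquivalence = record { isEquivalence = Setoid.isEquivalence ~-setoid ; _≟_ = _~?_ } }

abstract
  representatives : ℕ → List RootedTree
  representatives n = deduplicate _~?_ (filter (λ t → size t ≟ n) (trees≤ n))

  representatives-unique : ∀ n → Unique (representatives n)
  representatives-unique n = deduplicate-! ~-decSetoid _

  ∈-representatives⁺ : ∀ {n} t → size t ≡ n → t ∈ representatives n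
  ∈-representatives⁺ {n} t refl = SetoidMembershipₚ.∈-deduplicate⁺ ~-setoid _~?_ (λ e f → ~-trans f (~-sym e))
    (Any.map (λ { refl → ~-refl }) (∈-filter⁺ (λ t → size t ≟ n) (∈-trees≤ n t ≤-refl) refl))

  ∈-representatives⁻ : ∀ {n t} → t ∈ representatives n → size t ≡ n
  ∈-representatives⁻ {n} {t} t∈ =
    proj₂ (SetoidMembershipₚ.∈-filter⁻ ~-setoid (λ t → size t ≟ n) (λ e s → trans (sym (size-resp-~ e)) s)
      {xs = trees≤ n} (SetoidMembershipₚ.∈-deduplicate⁻ ~-setoid _~?_ (filter (λ t → size t ≟ n) (trees≤ n)) t∈))

-- Replacing a limb by a forest

-- Replace h G t t′ s: a limb of t isomorphic to h, other than t itself, is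
-- replaced by the forest G hung at its parent, giving t′; the limb of t′ at
-- that parent is s.  In Replaces, nothing stands for a parent above the forest.
mutual
  data Replace (h : RootedTree) (G : Forest) : RootedTree → RootedTree → RootedTree → Set where
    node : ∀ {ts ts′ m} → Replaces h G ts ts′ m → Replace h G (node ts) (node ts′) (fromMaybe (node ts′) m)

  data Replaces (h : RootedTree) (G : Forest) : Forest → Forest → Maybe RootedTree → Set where
    here   : ∀ {t ts} → t ~ h → Replaces h G (t ∷ ts) (G ++ ts) nothing
    inside : ∀ {t t′ s ts} → Replace h G t t′ s → Replaces h G (t ∷ ts) (t′ ∷ ts) (just s)
    later  : ∀ {t ts ts′ m} → Replaces h G ts ts′ m → Replaces h G (t ∷ ts) (t ∷ ts′) m

-- The tree produced by a move occurs among the `representatives` only up to `_~_`, so the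
-- replacement that undoes the move has to be carried over to the representative.
Replace-resp-~ : ∀ {h G t u t′ s} → t ~ u → Replace h G t t′ s →
                 ∃[ u′ ] ∃[ r ] Replace h G u u′ r × t′ ~ u′ × s ~ r
Replace-resp-~ {h} {G} p = proj₂ (~-Induction.ind P P* node-case
  (~*-refl , λ ()) cons-case swap-case
  (λ (p , f) (q , g) → Perm.trans p q , λ x →
    let _ , _ , y , e  , e′ = f x
        _ , _ , z , e₂ , e₃ = g y
    in  _ , _ , z , ↭-trans e e₂ , Maybe.trans ~-trans e′ e₃) p)
  where
  P : RootedTree → RootedTree → Set
  P t u = t ~ u × (∀ {t′ s} → Replace h G t t′ s → ∃[ u′ ] ∃[ r ] Replace h G u u′ r × t′ ~ u′ × s ~ r)

  P* : Forest → Forest → Set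
  P* ts us = ts ~* us × (∀ {ts′ m} → Replaces h G ts ts′ m →
               ∃[ us′ ] ∃[ k ] Replaces h G us us′ k × ts′ ~* us′ × Maybe.Pointwise _~_ m k)

  node-case : ∀ {ts us} → P* ts us → P (node ts) (node us)
  node-case (p , f) = node p , λ { (node x) → lift (f x) }
    where
    fromMaybe-cong : ∀ {t u m k} → t ~ u → Maybe.Pointwise _~_ m k → fromMaybe t m ~ fromMaybe u k
    fromMaybe-cong _ (just e) = e
    fromMaybe-cong e nothing  = e

    lift : ∀ {us ts′ m} → (∃[ us′ ] ∃[ k ] Replaces h G us us′ k × ts′ ~* us′ × Maybe.Pointwise _~_ m k) →
           ∃[ u′ ] ∃[ r ] Replace h G (node us) u′ r × node ts′ ~ u′ × fromMaybe (node ts′) m ~ r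
    lift (_ , _ , y , e , e′) = _ , _ , node y , node e , fromMaybe-cong (node e) e′

  cons-case : ∀ {t u ts us} → P t u → P* ts us → P* (t ∷ ts) (u ∷ us)
  cons-case (e , f) (p , g) = Perm.prep e p , λ where
    (here t~h)  → _ , _ , here (~-trans (~-sym e) t~h) , ++⁺ˡ G p , nothing
    (inside x) → let _ , _ , y , e₁ , e₂ = f x in _ , _ , inside y , Perm.prep e₁ p , just e₂
    (later x)  → let _ , _ , y , e₁ , e₂ = g x in _ , _ , later y , Perm.prep e e₁ , e₂

  swap-case : ∀ t u ts → P* (t ∷ u ∷ ts) (u ∷ t ∷ ts)
  swap-case t u ts = ↭-swap _ _ ~*-refl , λ where
    (here t~h)         → _ , _ , later (here t~h) , shift ~-refl G ts , nothing
    (inside x)         → _ , _ , later (inside x) , ↭-swap _ _ ~*-refl , just ~-refl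
    (later (here u~h)) → _ , _ , here u~h , ↭-sym (shift ~-refl G ts) , nothing
    (later (inside x)) → _ , _ , inside x , ↭-swap _ _ ~*-refl , just ~-refl
    (later (later x))  → _ , _ , later (later x) , ↭-swap _ _ ~*-refl , Maybe.refl ~-refl

sizes-++ : ∀ ts us → sizes (ts ++ us) ≡ sizes ts + sizes us
sizes-++ []       us = refl
sizes-++ (t ∷ ts) us = trans (cong (size t +_) (sizes-++ ts us)) (sym (+-assoc (size t) _ _))

occs-++ : ∀ h ts us → occs h (ts ++ us) ≡ occs h ts + occs h us
occs-++ h []       us = refl
occs-++ h (t ∷ ts) us = trans (cong (occ h t +_) (occs-++ h ts us)) (sym (+-assoc (occ h t) _ _))

mutual
  Replace-size : ∀ {h G t t′ s} → Replace h G t t′ s → size t + sizes G ≡ size t′ + size h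
  Replace-size (node x) = cong suc (Replaces-sizes x)

  Replaces-sizes : ∀ {h G ts ts′ m} → Replaces h G ts ts′ m → sizes ts + sizes G ≡ sizes ts′ + size h
  Replaces-sizes {h} {G} (here {t} {ts} e) = begin
    size t + sizes ts + sizes G  ≡⟨ cong (λ x → x + sizes ts + sizes G) (size-resp-~ e) ⟩
    size h + sizes ts + sizes G  ≡⟨ +-assoc (size h) _ _ ⟩
    size h + (sizes ts + sizes G) ≡⟨ +-comm (size h) _ ⟩
    sizes ts + sizes G + size h  ≡⟨ cong (_+ size h) (+-comm (sizes ts) _) ⟩
    sizes G + sizes ts + size h  ≡⟨ cong (_+ size h) (sizes-++ G ts) ⟨
    sizes (G ++ ts) + size h     ∎
    where open ≡-Reasoning
  Replaces-sizes {h} {G} (inside {t} {t′} {ts = ts} x) = begin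
    size t + sizes ts + sizes G   ≡⟨ +-comm-tail (size t) ⟩
    size t + sizes G + sizes ts   ≡⟨ cong (_+ sizes ts) (Replace-size x) ⟩
    size t′ + size h + sizes ts   ≡⟨ +-comm-tail (size t′) ⟩
    size t′ + sizes ts + size h   ∎
    where
    open ≡-Reasoning
    +-comm-tail : ∀ a {b c} → a + b + c ≡ a + c + b
    +-comm-tail a {b} {c} = trans (+-assoc a b c) (trans (cong (a +_) (+-comm b c)) (sym (+-assoc a c b)))
  Replaces-sizes {h} {G} (later {t} {ts} {ts′} x) =
    trans (+-assoc (size t) _ _) (trans (cong (size t +_) (Replaces-sizes x)) (sym (+-assoc (size t) _ _)))

mutual
  Replace-size-> : ∀ {h G t t′ s} → Replace h G t t′ s → size h < size t
  Replace-size-> (node x) = s≤s (Replaces-sizes-≥ x)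

  Replaces-sizes-≥ : ∀ {h G ts ts′ m} → Replaces h G ts ts′ m → size h ≤ sizes ts
  Replaces-sizes-≥ (here e)            = ≤-trans (≤-reflexive (sym (size-resp-~ e))) (m≤m+n _ _)
  Replaces-sizes-≥ (inside x)          = ≤-trans (<⇒≤ (Replace-size-> x)) (m≤m+n _ _)
  Replaces-sizes-≥ (later {t = t} x)   = ≤-trans (Replaces-sizes-≥ x) (m≤n+m _ (size t))

module _ {h k : RootedTree} {G : Forest} (k≤h : size k ≤ size h) where
  mutual
    -- The ancestors of the replaced limb in `t` are larger than `h`, hence larger than `k`, and so
    -- are not copies of `k`. Every copy of `k` thus lies in the replaced limb or survives in `t′`.
    Replace-occ : ∀ {t t′ s} → Replace h G t t′ s → occ k t ≤ occ k h + occ k t′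
    Replace-occ {node ts} {node ts′} r@(node x) = begin
      occ k (node ts)             ≡⟨ occ-larger k ts (≤-<-trans k≤h (Replace-size-> r)) ⟩
      occs k ts                   ≤⟨ Replaces-occs x ⟩
      occ k h + occs k ts′        ≤⟨ +-monoʳ-≤ (occ k h) (occs≤occ k ts′) ⟩
      occ k h + occ k (node ts′)  ∎
      where open ≤-Reasoning

    Replaces-occs : ∀ {ts ts′ m} → Replaces h G ts ts′ m → occs k ts ≤ occ k h + occs k ts′
    Replaces-occs (here {t} {ts} e) = begin
      occ k t + occs k ts          ≡⟨ cong (_+ occs k ts) (occ-resp-~ k e) ⟩
      occ k h + occs k ts          ≤⟨ +-monoʳ-≤ (occ k h) (m≤n+m _ (occs k G)) ⟩
      occ k h + (occs k G + occs k ts) ≡⟨ cong (occ k h +_) (occs-++ k G ts) ⟨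
      occ k h + occs k (G ++ ts)   ∎
      where open ≤-Reasoning
    Replaces-occs (inside {t} {t′} {ts = ts} x) =
      ≤-trans (+-monoˡ-≤ (occs k ts) (Replace-occ x)) (≤-reflexive (+-assoc (occ k h) _ _))
    Replaces-occs (later {t} {ts} {ts′} x) =
      ≤-trans (+-monoʳ-≤ (occ k t) (Replaces-occs x)) (≤-reflexive (+-exchange (occ k t) (occ k h) _))

module _ (h : RootedTree) (G : Forest) where
  mutual
    replacements : RootedTree → List (RootedTree × RootedTree)
    replacements (node ts) = map (λ (ts′ , m) → node ts′ , fromMaybe (node ts′) m) (forest-replacements ts)

    forest-replacements : Forest → List (Forest × Maybe RootedTree)
    forest-replacements []       = []
    forest-replacements (t ∷ ts) = head-replacement t ts
      ++ map (λ (t′ , s) → t′ ∷ ts , just s) (replacements t)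
      ++ map (λ (ts′ , m) → t ∷ ts′ , m) (forest-replacements ts)

    head-replacement : RootedTree → Forest → List (Forest × Maybe RootedTree)
    head-replacement t ts with t ~? h
    ... | yes _ = (G ++ ts , nothing) ∷ []
    ... | no  _ = []

  mutual
    ∈-replacements : ∀ {t t′ s} → Replace h G t t′ s → (t′ , s) ∈ₚ replacements t
    ∈-replacements (node x) = ∈-map⁺ _ (∈-forest-replacements x)

    ∈-forest-replacements : ∀ {ts ts′ m} → Replaces h G ts ts′ m → (ts′ , m) ∈ₚ forest-replacements ts
    ∈-forest-replacements (here {t} {ts} e) = ∈-++⁺ˡ (go e)
      where
      go : t ~ h → (G ++ ts , nothing) ∈ₚ head-replacement t ts
      go e with t ~? h
      ... | yes _ = here refl
      ... | no ¬e = contradiction e ¬e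
    ∈-forest-replacements (inside {t} {ts = ts} x) =
      ∈-++⁺ʳ (head-replacement t ts) (∈-++⁺ˡ (∈-map⁺ _ (∈-replacements x)))
    ∈-forest-replacements (later {t} {ts} x) =
      ∈-++⁺ʳ (head-replacement t ts) (∈-++⁺ʳ (map _ (replacements t)) (∈-map⁺ _ (∈-forest-replacements x)))

  mutual
    length-replacements : ∀ ts → length (replacements (node ts)) ≡ occs h ts
    length-replacements ts = trans (length-map _ (forest-replacements ts)) (length-forest-replacements ts)

    length-forest-replacements : ∀ ts → length (forest-replacements ts) ≡ occs h ts
    length-forest-replacements []       = refl
    length-forest-replacements (t@(node us) ∷ ts) = begin
      length (head-replacement t ts ++ map _ (replacements t) ++ map _ (forest-replacements ts))
        ≡⟨ length-++ (head-replacement t ts) ⟩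
      length (head-replacement t ts) + length (map _ (replacements t) ++ map _ (forest-replacements ts))
        ≡⟨ cong₂ _+_ (length-head t) (length-++ (map _ (replacements t))) ⟩
      indicator (t ~? h) + (length (map _ (replacements t)) + length (map _ (forest-replacements ts)))
        ≡⟨ cong (indicator (t ~? h) +_) (cong₂ _+_
             (trans (length-map _ (replacements t)) (length-replacements us))
             (trans (length-map _ (forest-replacements ts)) (length-forest-replacements ts))) ⟩
      indicator (t ~? h) + (occs h us + occs h ts)
        ≡⟨ +-assoc (indicator (t ~? h)) _ _ ⟨
      occ h t + occs h ts ∎
      where
      open ≡-Reasoning
      length-head : ∀ t → length (head-replacement t ts) ≡ indicator (t ~? h)
      length-head t with t ~? h
      ... | yes _ = refl
      ... | no  _ = refl

-- Each outcome comes from its own copy of `h`, so the occurrence count bounds the ambiguity of a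
-- move.
length-replacements-≤ : ∀ h G t → length (replacements h G t) ≤ occ h t
length-replacements-≤ h G (node ts) = ≤-trans (≤-reflexive (length-replacements h G ts)) (occs≤occ h ts)

-- Growing is a replacement read backwards with the empty forest: deleting the new copy of `h` from
-- the grown tree returns `t`, and the limb recorded at its parent is the original limb at `v`. The
-- pair (tree, limb) can thus be recovered.
insertion : ∀ h {t} (v : Vertex t) → ∃[ u ] Replace h [] u t (limb v)
insertion h {node ts} root  = node (h ∷ ts) , node (here ~-refl)
insertion h (below {ts} i v) = let us , x = go ts i v in node us , node x
  where
  go : ∀ ts i (v : Vertex (lookup ts i)) → ∃[ us ] Replaces h [] us ts (just (limb v))
  go (t ∷ ts) zero    v = let u , x = insertion h v in u ∷ ts , inside x
  go (t ∷ ts) (suc i) v = let us , x = go ts i v in t ∷ us , later x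

length-concatMap-≤ : ∀ {A B : Set} (f : A → List B) b → (∀ x → length (f x) ≤ b) →
                     ∀ xs → length (concatMap f xs) ≤ length xs * b
length-concatMap-≤ f b f≤b []       = z≤n
length-concatMap-≤ f b f≤b (x ∷ xs) =
  ≤-trans (≤-reflexive (length-++ (f x))) (+-mono-≤ (f≤b x) (length-concatMap-≤ f b f≤b xs))

any-concatMap : ∀ {A B : Set} {P : B → Set} (f : A → List B) {xs x} →
                x ∈ₚ xs → Any P (f x) → Any P (concatMap f xs)
any-concatMap f x∈xs p = Anyₚ.concatMap⁺ f (Any.map (λ { refl → p }) x∈xs)

length-take-≤ : ∀ {A : Set} k (xs : List A) → length (take k xs) ≤ k
length-take-≤ k xs = ≤-trans (≤-reflexive (length-take k xs)) (m⊓n≤m k _)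

-- Truncating to `k` outcomes gives a length bound valid for all trees, and nothing is lost on those
-- with at most `k` copies of `h`.
∈-take-replacements : ∀ h G t k {x} → occ h t ≤ k → x ∈ₚ replacements h G t → x ∈ₚ take k (replacements h G t)
∈-take-replacements h G t k t≤k =
  subst (_ ∈ₚ_) (sym (take-all k _ (≤-trans (length-replacements-≤ h G t) t≤k)))

-- Shrinking trees that avoid the limb

SiblingGroup : ℕ → Forest → Set
SiblingGroup s ts = Σ[ G ∈ Forest ] s ≤ sizes G × sizes G < 2 * s ×
  (∀ h → ∃[ ts₁ ] ∃[ ts′ ] ∃[ m ] Replaces h G ts₁ ts′ m × ts′ ~* ts)

-- Descend into the first tree, or drop it, as long as what remains still has `s` vertices. The
-- replacement is given for every `h`, because the chain put in place of `G` is chosen only once the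
-- size of `G` is known.
siblingGroup : ∀ s ts → 0 < s → s ≤ sizes ts → SiblingGroup s ts
siblingGroup s [] 0<s s≤0 = contradiction (≤-trans 0<s s≤0) λ ()
siblingGroup s (node us ∷ ts) 0<s s≤ with s ≤? sizes us | s ≤? sizes ts
... | yes s≤us | _ = let G , G≥ , G< , f = siblingGroup s us 0<s s≤us in G , G≥ , G< , λ h →
  let _ , _ , _ , x , e = f h in _ , _ , _ , inside (node x) , Perm.prep (node e) ~*-refl
... | no _ | yes s≤ts = let G , G≥ , G< , f = siblingGroup s ts 0<s s≤ts in G , G≥ , G< , λ h →
  let _ , _ , _ , x , e = f h in _ , _ , _ , later x , Perm.prep ~-refl e
-- The first tree has at most `s` vertices, root included, and the others together fewer than `s`,
-- so the whole list stays below `2 * s`.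
... | no s≰us | no s≰ts = node us ∷ ts , s≤ ,
  ≤-trans (+-mono-≤-< {suc (sizes us)} (≰⇒> s≰us) (≰⇒> s≰ts)) (≤-reflexive (cong (s +_) (sym (+-identityʳ s)))) ,
  λ h → h ∷ [] , _ , _ , here ~-refl , subst (_~* node us ∷ ts) (sym (++-identityʳ _)) ~*-refl

-- A limb of a limb is a limb, so a copy of `h` in `t` would bring a copy of `k` with it.
occ-0-closed : ∀ {h k} → 0 < occ k h → ∀ t → occ k t ≡ 0 → occ h t ≡ 0
occ-0-closed {h} {k} 0<k t t≡0 with occ h t in eq
... | zero  = refl
... | suc _ = contradiction (≤-trans 0<k (≤-trans (≤-reflexive (sym (occ-resp-~ k (≅⇒~ _ _ e)))) (occ-limb k v)))
                (subst (λ n → ¬ 0 < n) (sym t≡0) λ ())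
  where
  hasLimb = occ⇒limb {h} t (subst (0 <_) (sym eq) z<s)
  v = proj₁ hasLimb
  e = proj₂ hasLimb

-- There are `suc r` vertices above `L`, at least one, so a tower is always strictly larger than
-- `L`.
tower : RootedTree → ℕ → RootedTree
tower L zero    = node (L ∷ [])
tower L (suc r) = node (tower L r ∷ [])

size-tower : ∀ L r → size (tower L r) ≡ suc r + size L
size-tower L zero    = cong suc (+-identityʳ _)
size-tower L (suc r) = cong suc (trans (+-identityʳ _) (size-tower L r))

L<tower : ∀ L r → size L < size (tower L r)
L<tower L r = ≤-trans (s≤s (m≤n+m (size L) r)) (≤-reflexive (sym (size-tower L r)))

occ-tower : ∀ L r → occ L (tower L r) ≡ 1
occ-tower L zero    = trans (occ-larger L (L ∷ []) (L<tower L zero)) (trans (+-identityʳ _) (occ-self L))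
occ-tower L (suc r) = trans (occ-larger L (tower L r ∷ []) (L<tower L (suc r)))
  (trans (+-identityʳ _) (occ-tower L r))

module _ (L : RootedTree) where

  private
    l s : ℕ
    l = size L
    -- A group of `s + r` vertices exceeds `tower L r`, which has `l + suc r`, by exactly `l`.
    -- Growing by one copy of `L` later restores the original size.
    s = suc (2 * l)

  -- The list `sparse` receives the shrunken trees. At most one old copy of `L`, together with the
  -- new one, makes growing at most two-to-one.
  avoiders sparse : ℕ → List RootedTree
  avoiders n = filter (λ t → occ L t ≟ 0) (representatives n)
  sparse   n = filter (λ t → occ L t ≤? 1) (representatives n)

  avoiders-unique : ∀ n → Unique (avoiders n)
  avoiders-unique n = SetoidUniqueₚ.filter⁺ ~-setoid (λ t → occ L t ≟ 0) (representatives-unique n)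

  sparse-unique : ∀ n → Unique (sparse n)
  sparse-unique n = SetoidUniqueₚ.filter⁺ ~-setoid (λ t → occ L t ≤? 1) (representatives-unique n)

  ∈-avoiders⁻ : ∀ {n t} → t ∈ avoiders n → size t ≡ n × occ L t ≡ 0
  ∈-avoiders⁻ {n} t∈ =
    let t∈reps , e = SetoidMembershipₚ.∈-filter⁻ ~-setoid (λ t → occ L t ≟ 0)
                       (λ e → subst (_≡ 0) (occ-resp-~ L e)) {xs = representatives n} t∈
    in ∈-representatives⁻ t∈reps , e

  ∈-sparse⁺ : ∀ {n} t → size t ≡ n → occ L t ≤ 1 → t ∈ sparse n
  ∈-sparse⁺ t e o = SetoidMembershipₚ.∈-filter⁺ ~-setoid (λ t → occ L t ≤? 1)
    (λ e → subst (_≤ 1) (occ-resp-~ L e)) (∈-representatives⁺ t e) o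

  ∈-sparse⁻ : ∀ {n t} → t ∈ sparse n → size t ≡ n × occ L t ≤ 1
  ∈-sparse⁻ {n} t∈ =
    let t∈reps , e = SetoidMembershipₚ.∈-filter⁻ ~-setoid (λ t → occ L t ≤? 1)
                       (λ e → subst (_≤ 1) (occ-resp-~ L e)) {xs = representatives n} t∈
    in ∈-representatives⁻ t∈reps , e

  -- The length of the chain is chosen to make the marked tree exactly l vertices smaller.
  mark : ∀ t → occ L t ≡ 0 → s < size t →
         ∃[ r ] Σ[ G ∈ Forest ] r < s × sizes G ≤ 2 * s × ∃[ t₁ ] ∃[ t′ ] ∃[ u ]
           Replace (tower L r) G t₁ t′ u × t′ ~ t × size t₁ + l ≡ size t ×
           occ L t₁ ≤ 1 × occ (tower L r) t₁ ≤ 1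
  mark t@(node ts) t≡0 (s≤s s≤ts) with siblingGroup s ts z<s s≤ts
  ... | G , s≤G , G<2s , replaceable with replaceable (tower L (sizes G ∸ s))
  ... | ts₁ , ts′ , m , x , e = r , G , r<s , <⇒≤ G<2s , node ts₁ , node ts′ , _ , node x , node e ,
    +-cancelʳ-≡ (l + suc r) _ _ size-eq ,
    (begin
      occ L (node ts₁)            ≤⟨ Replace-occ (<⇒≤ (L<tower L r)) (node x) ⟩
      occ L (tower L r) + occ L (node ts′) ≡⟨ cong₂ _+_ (occ-tower L r) t′≡0 ⟩
      1 ∎) ,
    (begin
      occ (tower L r) (node ts₁)  ≤⟨ Replace-occ ≤-refl (node x) ⟩
      occ (tower L r) (tower L r) + occ (tower L r) (node ts′)
        ≡⟨ cong₂ _+_ (occ-self (tower L r))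
             (occ-0-closed (≤-reflexive (sym (occ-tower L r))) (node ts′) t′≡0) ⟩
      1 ∎)
    where
    r = sizes G ∸ s

    r<s : r < s
    r<s = +-cancelˡ-< s r s (subst₂ _<_ (sym (m+[n∸m]≡n s≤G)) (cong (s +_) (+-identityʳ s)) G<2s)

    t′≡0 : occ L (node ts′) ≡ 0
    t′≡0 = trans (occ-resp-~ L (node e)) t≡0

    size-eq : size (node ts₁) + l + (l + suc r) ≡ size t + (l + suc r)
    size-eq = begin-equality
      size (node ts₁) + l + (l + suc r)    ≡⟨ +-assoc (size (node ts₁)) l _ ⟩
      size (node ts₁) + (l + (l + suc r))  ≡⟨ cong (size (node ts₁) +_) (begin-equality
          l + (l + suc r)  ≡⟨ +-assoc l l (suc r) ⟨
          l + l + suc r    ≡⟨ +-suc (l + l) r ⟩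
          suc (l + l) + r  ≡⟨ cong (λ x → suc (l + x) + r) (+-identityʳ l) ⟨
          s + r            ≡⟨ m+[n∸m]≡n s≤G ⟩
          sizes G          ∎) ⟩
      size (node ts₁) + sizes G            ≡⟨ Replace-size (node x) ⟩
      size (node ts′) + size (tower L r)   ≡⟨ cong₂ _+_ (size-resp-~ (node e))
                                                (trans (size-tower L r) (+-comm (suc r) l)) ⟩
      size t + (l + suc r) ∎
      where open ≤-Reasoning

    open ≤-Reasoning

  ambiguity : ℕ
  ambiguity = s * length (forests≤ (2 * s))

  -- An avoiding tree is recovered from its marked tree by guessing the chain length `r` and the
  -- group `G`, which is what `ambiguity` counts. The position is then forced, since `tower L r`
  -- occurs at most once in the marked tree; hence `take 1`.
  avoiders-bound : ∀ m → s < m + l → length (avoiders (m + l)) ≤ ambiguity * length (sparse m)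
  avoiders-bound m s<m+l = begin
    length (avoiders (m + l))      ≤⟨ unique-⊆⇒length-≤ ~-setoid (avoiders-unique (m + l)) avoiders⊆ ⟩
    length unmarkings
      ≤⟨ length-concatMap-≤ unmark₁ _ (λ r →
           length-concatMap-≤ (unmark₂ r) _ (λ G →
             length-concatMap-≤ (unmark₃ r G) 1 (length-unmark₃ r G) (sparse m))
           (forests≤ (2 * s))) (upTo s) ⟩
    length (upTo s) * (length (forests≤ (2 * s)) * (length (sparse m) * 1))
      ≡⟨ cong₂ (λ a b → a * (length (forests≤ (2 * s)) * b)) (length-upTo s) (*-identityʳ _) ⟩
    s * (length (forests≤ (2 * s)) * length (sparse m))
      ≡⟨ *-assoc s (length (forests≤ (2 * s))) (length (sparse m)) ⟨
    ambiguity * length (sparse m)  ∎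
    where
    open ≤-Reasoning

    unmark₃ : ℕ → Forest → RootedTree → List RootedTree
    unmark₃ r G t = map proj₁ (take 1 (replacements (tower L r) G t))

    length-unmark₃ : ∀ r G t → length (unmark₃ r G t) ≤ 1
    length-unmark₃ r G t = ≤-trans (≤-reflexive (length-map proj₁ (take 1 (replacements (tower L r) G t))))
                                   (length-take-≤ 1 (replacements (tower L r) G t))

    unmark₂ : ℕ → Forest → List RootedTree
    unmark₂ r G = concatMap (unmark₃ r G) (sparse m)

    unmark₁ : ℕ → List RootedTree
    unmark₁ r = concatMap (unmark₂ r) (forests≤ (2 * s))

    unmarkings : List RootedTree
    unmarkings = concatMap unmark₁ (upTo s)

    avoiders⊆ : ∀ {t} → t ∈ avoiders (m + l) → t ∈ unmarkings
    avoiders⊆ {t} t∈ with ∈-avoiders⁻ t∈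
    ... | size-t , t≡0 with mark t t≡0 (subst (s <_) (sym size-t) s<m+l)
    ... | r , G , r<s , G≤2s , t₁ , t′ , u , x , t′~t , size-t₁ , o₁ , o₂ =
      any-concatMap unmark₁ (∈-upTo⁺ r<s)
        (any-concatMap (unmark₂ r) (∈-forests≤ (2 * s) G G≤2s)
          (Anyₚ.concatMap⁺ (unmark₃ r G) (Any.map recover
            (∈-sparse⁺ t₁ (+-cancelʳ-≡ l _ _ (trans size-t₁ size-t)) o₁))))
      where
      recover : ∀ {t₂} → t₁ ~ t₂ → t ∈ unmark₃ r G t₂
      recover {t₂} t₁~t₂ = let _ , _ , y , e , _ = Replace-resp-~ t₁~t₂ x in
        Anyₚ.map⁺ (lose
          (∈-take-replacements (tower L r) G t₂ 1 (subst (_≤ 1) (occ-resp-~ (tower L r) t₁~t₂) o₂)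
            (∈-replacements _ _ y))
          (~-trans (~-sym t′~t) e))

-- The isomorphism classes of the limbs of a tree

∈-resp : ∀ {t u} {cs : Forest} → t ~ u → t ∈ cs → u ∈ cs
∈-resp e = Any.map (~-trans (~-sym e))

mutual
  -- A new tree is put in front of the classes of its proper limbs. A tree already represented is
  -- skipped with everything below it, which is harmless when the accumulator is `Closed`.
  collect : RootedTree → Forest → Forest
  collect (node ts) cs with Any.any? (node ts ~?_) cs
  ... | yes _ = cs
  ... | no  _ = node ts ∷ collects ts cs

  collects : Forest → Forest → Forest
  collects []       cs = cs
  collects (t ∷ ts) cs = collect t (collects ts cs)

mutual
  ∈-collect⁺ : ∀ {x} t {cs} → x ∈ cs → x ∈ collect t cs
  ∈-collect⁺ (node ts) {cs} p with Any.any? (node ts ~?_) cs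
  ... | yes _ = p
  ... | no  _ = there (∈-collects⁺ ts p)

  ∈-collects⁺ : ∀ {x} ts {cs} → x ∈ cs → x ∈ collects ts cs
  ∈-collects⁺ []       p = p
  ∈-collects⁺ (t ∷ ts) p = ∈-collect⁺ t (∈-collects⁺ ts p)

self-∈-collect : ∀ t cs → t ∈ collect t cs
self-∈-collect (node ts) cs with Any.any? (node ts ~?_) cs
... | yes p = p
... | no  _ = here ~-refl

all-∈-collects : ∀ ts cs → All (_∈ collects ts cs) ts
all-∈-collects []       cs = []
all-∈-collects (t ∷ ts) cs = self-∈-collect t (collects ts cs) ∷ All.map (∈-collect⁺ t) (all-∈-collects ts cs)

mutual
  ∈-collect⁻ : ∀ {x} t {cs} → x ∈ collect t cs → x ∈ cs ⊎ HasMaximalLimb x t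
  ∈-collect⁻ (node ts) {cs} p with Any.any? (node ts ~?_) cs
  ... | yes _ = inj₁ p
  ∈-collect⁻ (node ts) {cs} (here e) | no _ = inj₂ (root , ~⇒≅ (~-sym e))
  ∈-collect⁻ (node ts) {cs} (there p) | no _ with ∈-collects⁻ ts p
  ... | inj₁ q           = inj₁ q
  ... | inj₂ (i , v , e) = inj₂ (below i v , e)

  ∈-collects⁻ : ∀ {x} ts {cs} → x ∈ collects ts cs → x ∈ cs ⊎ ∃[ i ] HasMaximalLimb x (lookup ts i)
  ∈-collects⁻ []       p = inj₁ p
  ∈-collects⁻ (t ∷ ts) p with ∈-collect⁻ t p
  ... | inj₂ l = inj₂ (zero , l)
  ... | inj₁ q with ∈-collects⁻ ts q
  ...   | inj₁ r       = inj₁ r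
  ...   | inj₂ (i , l) = inj₂ (suc i , l)

size-lookup : ∀ ts i → size (lookup ts i) ≤ sizes ts
size-lookup (t ∷ ts) zero    = m≤m+n _ _
size-lookup (t ∷ ts) (suc i) = ≤-trans (size-lookup ts i) (m≤n+m _ (size t))

size-limb : ∀ {t} (v : Vertex t) → size (limb v) ≤ size t
size-limb root              = ≤-refl
size-limb (below {ts} i v) = m≤n⇒m≤1+n (≤-trans (size-limb v) (size-lookup ts i))

limb-size : ∀ {x t} → HasMaximalLimb x t → size x ≤ size t
limb-size (v , e) = ≤-trans (≤-reflexive (sym (size-resp-~ (≅⇒~ _ _ e)))) (size-limb v)

mutual
  collect-unique : ∀ t {cs} → Unique cs → Unique (collect t cs)
  collect-unique (node ts) {cs} cs! with Any.any? (node ts ~?_) cs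
  ... | yes _ = cs!
  -- Collecting the children cannot add the class of `node ts` itself, since every limb found there
  -- is smaller.
  ... | no ∉cs = Allₚ.¬Any⇒All¬ _ fresh ∷ collects-unique ts cs!
    where
    fresh : ¬ node ts ∈ collects ts cs
    fresh p with ∈-collects⁻ ts p
    ... | inj₁ q       = ∉cs q
    ... | inj₂ (i , l) = 1+n≰n (≤-trans (limb-size l) (size-lookup ts i))

  collects-unique : ∀ ts {cs} → Unique cs → Unique (collects ts cs)
  collects-unique []       cs! = cs!
  collects-unique (t ∷ ts) cs! = collect-unique t (collects-unique ts cs!)

-- The children of each listed tree occur, up to `_~_`, later in the list, so the list can be
-- rebuilt from its end.
data Closed : Forest → Set where
  []  : Closed []
  _∷_ : ∀ {ts cs} → All (_∈ cs) ts → Closed cs → Closed (node ts ∷ cs)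

mutual
  collect-closed : ∀ t {cs} → Closed cs → Closed (collect t cs)
  collect-closed (node ts) {cs} c with Any.any? (node ts ~?_) cs
  ... | yes _ = c
  ... | no  _ = all-∈-collects ts cs ∷ collects-closed ts c

  collects-closed : ∀ ts {cs} → Closed cs → Closed (collects ts cs)
  collects-closed []       c = c
  collects-closed (t ∷ ts) c = collect-closed t (collects-closed ts c)

limbClasses : RootedTree → Forest
limbClasses t = collect t []

limbClasses⇒limb : ∀ {x} t → x ∈ limbClasses t → HasMaximalLimb x t
limbClasses⇒limb t p with ∈-collect⁻ t p
... | inj₂ l = l

-- Trees with many limb classes

~×~ : Setoid 0ℓ 0ℓ
~×~ = ×-setoid ~-setoid ~-setoid

open SetoidMembership ~×~ using () renaming (_∈_ to _∈²_)
open SetoidUnique ~×~ using () renaming (Unique to Unique²)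

withClasses : Forest → List (RootedTree × RootedTree)
withClasses = concatMap λ t → map (t ,_) (limbClasses t)

∈-withClasses⁻ : ∀ {t x} ts → (t , x) ∈² withClasses ts →
                 Any (λ u → t ~ u × HasMaximalLimb x u) ts
∈-withClasses⁻ ts p = Any.map
  (λ {u} q → let e = Any.map proj₁ (Anyₚ.map⁻ q)
                 x∈ = Any.map proj₂ (Anyₚ.map⁻ q)
             in proj₂ (Any.satisfied e) , limbClasses⇒limb u x∈)
  (Anyₚ.concatMap⁻ (λ t → map (t ,_) (limbClasses t)) p)

withClasses-unique : ∀ {ts} → Unique ts → Unique² (withClasses ts)
withClasses-unique []              = []
withClasses-unique {t ∷ ts} (t≁ ∷ ts!) = AllPairsₚ.++⁺
  (AllPairsₚ.map⁺ (AllPairs.map (_∘ proj₂) (collect-unique t [])))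
  (withClasses-unique ts!)
  (Allₚ.map⁺ (All.universal (λ x → All.map (_∘ proj₁) (firsts t≁)) (limbClasses t)))
  where
  firsts : ∀ {ts} → All (λ u → ¬ t ~ u) ts → All (λ y → ¬ t ~ proj₁ y) (withClasses ts)
  firsts = Allₚ.concat⁺ ∘ Allₚ.map⁺ ∘ All.map λ t≁u → Allₚ.map⁺ (All.universal (λ _ → t≁u) _)

length-withClasses : ∀ {W ts} → All (λ t → W ≤ length (limbClasses t)) ts → length ts * W ≤ length (withClasses ts)
length-withClasses []                   = z≤n
length-withClasses {ts = t ∷ ts} (p ∷ ps) = ≤-trans
  (+-mono-≤ (≤-trans p (≤-reflexive (sym (length-map (t ,_) (limbClasses t))))) (length-withClasses ps))
  (≤-reflexive (sym (length-++ (map (t ,_) (limbClasses t)))))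

module _ (L : RootedTree) (W : ℕ) where

  diverse : ℕ → List RootedTree
  diverse n = filter (λ t → W ≤? length (limbClasses t)) (sparse L n)

  -- Double counting of pairs (tree, limb class): each diverse tree contributes at least `W` of
  -- them, and every pair is recovered by deleting one of at most two copies of `L` from a tree of
  -- size `m + size L`.
  diverse-bound : ∀ m → length (diverse m) * W ≤ length (representatives (m + size L)) * 2
  diverse-bound m = begin
    length (diverse m) * W
      ≤⟨ length-withClasses (Allₚ.all-filter (λ t → W ≤? length (limbClasses t)) (sparse L m)) ⟩
    length (withClasses (diverse m))
      ≤⟨ unique-⊆⇒length-≤ ~×~ (withClasses-unique
           (SetoidUniqueₚ.filter⁺ ~-setoid (λ t → W ≤? length (limbClasses t)) (sparse-unique L m))) ⊆ ⟩
    length (concatMap deletions (representatives (m + size L)))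
      ≤⟨ length-concatMap-≤ deletions 2 (λ t → length-take-≤ 2 (replacements L [] t)) (representatives (m + size L)) ⟩
    length (representatives (m + size L)) * 2 ∎
    where
    open ≤-Reasoning

    deletions : RootedTree → List (RootedTree × RootedTree)
    deletions t = take 2 (replacements L [] t)

    ⊆ : ∀ {y} → y ∈² withClasses (diverse m) → y ∈² concatMap deletions (representatives (m + size L))
    ⊆ {t , x} p with find (∈-withClasses⁻ (diverse m) p)
    ... | u , u∈ , t~u , v , x≅ with ∈-sparse⁻ L {m} (Any.map (λ { refl → ~-refl })
                                      (proj₁ (∈-filter⁻ (λ t → W ≤? length (limbClasses t)) {xs = sparse L m} u∈)))
                                   | insertion L v
    ...   | size-u , occ-u | u₂ , r =
      Anyₚ.concatMap⁺ deletions (Any.map recover (∈-representatives⁺ u₂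
        (trans (sym (+-identityʳ _)) (trans (Replace-size r) (cong (_+ size L) size-u)))))
      where
      recover : ∀ {u₃} → u₂ ~ u₃ → (t , x) ∈² deletions u₃
      recover {u₃} e = let _ , _ , y , e₁ , e₂ = Replace-resp-~ e r in
        lose
          (∈-take-replacements L [] u₃ 2
            (begin
              occ L u₃          ≡⟨ occ-resp-~ L e ⟨
              occ L u₂          ≤⟨ Replace-occ ≤-refl r ⟩
              -- One copy is the inserted one, and `u` has at most one of its own.
              occ L L + occ L u ≤⟨ +-mono-≤ (≤-reflexive (occ-self L)) occ-u ⟩
              2                 ∎)
            (∈-replacements _ _ y))
          (~-trans t~u e₁ , ~-trans (~-sym (≅⇒~ _ _ x≅)) e₂)

-- Trees with few limb classes

length-cartesianProductWith : ∀ {A B C : Set} (f : A → B → C) xs ys →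
                              length (cartesianProductWith f xs ys) ≡ length xs * length ys
length-cartesianProductWith f []       ys = refl
length-cartesianProductWith f (x ∷ xs) ys = trans (length-++ (map (f x) ys))
  (cong₂ _+_ (length-map (f x) ys) (length-cartesianProductWith f xs ys))

-- Each of the `k` positions holds an entry of `xs` or stays empty.
length-lists≤ : ∀ {A : Set} (xs : List A) k → length (lists≤ xs k) ≤ suc (length xs) ^ k
length-lists≤ xs zero    = ≤-refl
length-lists≤ xs (suc k) = begin
  suc (length (cartesianProductWith _∷_ xs (lists≤ xs k)))
    ≡⟨ cong suc (length-cartesianProductWith _∷_ xs (lists≤ xs k)) ⟩
  suc (length xs * length (lists≤ xs k))
    ≤⟨ +-mono-≤ (m^n>0 (suc (length xs)) k) (*-monoʳ-≤ (length xs) (length-lists≤ xs k)) ⟩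
  suc (length xs) ^ k + length xs * suc (length xs) ^ k ∎
  where open ≤-Reasoning

-- A tree is described by its limb classes, listed so that each comes after
-- the ones it is a limb of, and a row of multiplicities for each of them.
expand : List ℕ → Forest → Forest
expand (m ∷ ms) (t ∷ ts) = replicate m t ++ expand ms ts
expand _        _        = []

build : List (List ℕ) → Forest
build []       = []
build (r ∷ rs) = node (expand r (build rs)) ∷ build rs

decode : List (List ℕ) → RootedTree
-- A default value: the code of a tree has at least one row, since `limbClasses` is never empty.
decode []       = node []
decode (r ∷ rs) = node (expand r (build rs))

increment : ∀ {t} {bs : Forest} → t ∈ bs → List ℕ → List ℕ
increment _         []       = []
increment (here _)  (m ∷ ms) = suc m ∷ ms
increment (there p) (m ∷ ms) = m ∷ increment p ms

length-increment : ∀ {t bs} (p : t ∈ bs) ms → length (increment p ms) ≡ length ms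
length-increment (here _)  []       = refl
length-increment (there p) []       = refl
length-increment (here _)  (m ∷ ms) = refl
length-increment (there p) (m ∷ ms) = cong suc (length-increment p ms)

increment-≤ : ∀ {t bs k} (p : t ∈ bs) {ms} → All (_≤ k) ms → All (_≤ suc k) (increment p ms)
increment-≤ (here _)  []       = []
increment-≤ (there p) []       = []
increment-≤ (here _)  (q ∷ qs) = s≤s q ∷ All.map m≤n⇒m≤1+n qs
increment-≤ (there p) (q ∷ qs) = m≤n⇒m≤1+n q ∷ increment-≤ p qs

expand-increment : ∀ {t bs} (p : t ∈ bs) ms → length ms ≡ length bs →
                   t ∷ expand ms bs ~* expand (increment p ms) bs
expand-increment {bs = b ∷ bs} (here e)  (m ∷ ms) _  = Perm.prep e ~*-refl
expand-increment {bs = b ∷ bs} (there p) (m ∷ ms) eq = ↭-trans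
  (↭-sym (shift ~-refl (replicate m b) _))
  (++⁺ˡ (replicate m b) (expand-increment p ms (suc-injective eq)))

expand-zeros : ∀ (bs : Forest) → expand (replicate (length bs) 0) bs ≡ []
expand-zeros []       = refl
expand-zeros (b ∷ bs) = expand-zeros bs

multiplicities : ∀ {bs} ts → All (_∈ bs) ts →
                 ∃[ ms ] length ms ≡ length bs × All (_≤ length ts) ms × ts ~* expand ms bs
multiplicities {bs} [] [] = replicate (length bs) 0 , length-replicate _ , Allₚ.replicate⁺ _ z≤n ,
  subst ([] ~*_) (sym (expand-zeros bs)) ~*-refl
multiplicities (t ∷ ts) (p ∷ ps) = let ms , len , bound , e = multiplicities ts ps in
  increment p ms , trans (length-increment p ms) len , increment-≤ p bound ,
  ↭-trans (Perm.prep ~-refl e) (expand-increment p ms len)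

IsCode : ℕ → ℕ → List (List ℕ) → Set
IsCode m W = All (λ r → length r ≤ W × All (_< suc m) r)

∈-pointwise : ∀ {t} {cs bs : Forest} → Pointwise _~_ cs bs → t ∈ cs → t ∈ bs
∈-pointwise (e ∷ _)  (here e′) = here (~-trans e′ e)
∈-pointwise (_ ∷ es) (there p) = there (∈-pointwise es p)

-- Induction from the end of the list: the children of the head lie among the later classes, hence
-- among the trees rebuilt from the later rows, and one row of multiplicities describes them. A
-- multiplicity is at most the number of children, hence at most `m`.
encode : ∀ {m cs} → Closed cs → All (λ t → size t ≤ m) cs →
         ∃[ c ] length c ≡ length cs × IsCode m (length cs) c × Pointwise _~_ cs (build c)
encode []       []       = [] , refl , [] , []
encode {m} (_∷_ {ts} {cs} ts⊆ closed) (t≤m ∷ ts≤m) with encode closed ts≤m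
... | c , len , code , cs~ with multiplicities ts (All.map (∈-pointwise cs~) ts⊆)
... | ms , len′ , bound , e =
  ms ∷ c , cong suc len ,
  (m≤n⇒m≤1+n (≤-reflexive (trans len′ (sym (Pointwise-length cs~)))) ,
    All.map (λ k≤ → s≤s (≤-trans k≤ (≤-trans (m≤n⇒m≤1+n (length≤sizes ts)) t≤m))) bound)
    ∷ All.map (λ (a , b) → m≤n⇒m≤1+n a , b) code ,
  node e ∷ cs~

module _ (W m : ℕ) where

  rows : List (List ℕ)
  rows = lists≤ (upTo (suc m)) W

  codes : List (List (List ℕ))
  codes = lists≤ rows W

  length-codes : length codes ≤ (2 + m) ^ (suc W * W)
  length-codes = begin
    length codes            ≤⟨ length-lists≤ rows W ⟩
    suc (length rows) ^ W   ≤⟨ ^-monoˡ-≤ W (s≤s (length-lists≤ (upTo (suc m)) W)) ⟩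
    suc (suc (length (upTo (suc m))) ^ W) ^ W ≡⟨ cong (λ k → suc (suc k ^ W) ^ W) (length-upTo (suc m)) ⟩
    -- The added one is absorbed by a further factor `2 + m`, as `(2 + m) ^ W` is at least one.
    suc ((2 + m) ^ W) ^ W   ≤⟨ ^-monoˡ-≤ W (+-mono-≤ (m^n>0 (2 + m) W) (m≤m+n ((2 + m) ^ W) (m * (2 + m) ^ W))) ⟩
    ((2 + m) ^ suc W) ^ W   ≡⟨ ^-*-assoc (2 + m) (suc W) W ⟩
    (2 + m) ^ (suc W * W)   ∎
    where open ≤-Reasoning

  ∈-codes : ∀ {c k} → k ≤ W → length c ≡ k → IsCode m k c → c ∈ₚ codes
  ∈-codes k≤W len code = ∈-lists≤ W (≤-trans (≤-reflexive len) k≤W)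
    (All.map (λ (a , b) → ∈-lists≤ W (≤-trans a k≤W) (All.map ∈-upTo⁺ b)) code)

  head-decoded : ∀ {t cs c} → Pointwise _~_ (t ∷ cs) (build c) → t ~ decode c
  head-decoded {c = r ∷ rs} (e ∷ _) = e

  -- With an empty accumulator `collect` puts the tree itself first, so the first row of its code
  -- decodes to it.
  ∈-decoded : ∀ t → size t ≡ m → length (limbClasses t) < W → t ∈ map decode codes
  ∈-decoded (node ts) size-t few =
    Anyₚ.map⁺ (Any.map
      (λ c≡ → subst (λ c → node ts ~ decode c) c≡
                (head-decoded {c = proj₁ code} (proj₂ (proj₂ (proj₂ code)))))
      (∈-codes (<⇒≤ few) (proj₁ (proj₂ code)) (proj₁ (proj₂ (proj₂ code)))))
    where
    code = encode {m} (collect-closed (node ts) []) (All.tabulateₛ ~-setoid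
      (λ x∈ → ≤-trans (limb-size (limbClasses⇒limb (node ts) x∈)) (≤-reflexive size-t)))

module _ (L : RootedTree) (W : ℕ) where

  repetitive : ℕ → List RootedTree
  repetitive n = filter (λ t → ¬? (W ≤? length (limbClasses t))) (sparse L n)

  repetitive-bound : ∀ m → length (repetitive m) ≤ (2 + m) ^ (suc W * W)
  repetitive-bound m = begin
    length (repetitive m)           ≤⟨ unique-⊆⇒length-≤ ~-setoid
      (SetoidUniqueₚ.filter⁺ ~-setoid (λ t → ¬? (W ≤? length (limbClasses t))) (sparse-unique L m)) ⊆ ⟩
    length (map decode (codes W m)) ≡⟨ length-map decode (codes W m) ⟩
    length (codes W m)            ≤⟨ length-codes W m ⟩
    (2 + m) ^ (suc W * W)         ∎
    where
    open ≤-Reasoning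
    ⊆ : ∀ {t} → t ∈ repetitive m → t ∈ map decode (codes W m)
    ⊆ p with find p
    ... | u , u∈ , t~u =
      let u∈sparse , few = ∈-filter⁻ (λ t → ¬? (W ≤? length (limbClasses t))) {xs = sparse L m} u∈
          size-u , _ = ∈-sparse⁻ L {m} (Any.map (λ { refl → ~-refl }) u∈sparse)
      in ∈-resp (~-sym t~u) (∈-decoded W m u size-u (≰⇒> few))

length-filter-¬ : ∀ {A : Set} {P : A → Set} (P? : Decidable P) xs →
                  length (filter P? xs) + length (filter (λ x → ¬? (P? x)) xs) ≡ length xs
length-filter-¬ P? []       = refl
length-filter-¬ P? (x ∷ xs) with P? x
... | yes _ = cong suc (length-filter-¬ P? xs)
... | no  _ = trans (+-suc _ _) (cong suc (length-filter-¬ P? xs))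

-- The number of trees grows exponentially

leaf : RootedTree
leaf = node []

withTwoLeaves withPath : RootedTree → RootedTree
withTwoLeaves t = node (leaf ∷ leaf ∷ t ∷ [])
withPath      t = node (node (leaf ∷ []) ∷ t ∷ [])

singleton-~ : ∀ {t u : RootedTree} → t ∷ [] ~* u ∷ [] → t ~ u
singleton-~ p with ∈-resp-↭ p (here ~-refl)
... | here e = e

withTwoLeaves-injective : ∀ {t u} → withTwoLeaves t ~ withTwoLeaves u → t ~ u
withTwoLeaves-injective (node p) = singleton-~ (drop-∷ (drop-∷ p))

withPath-injective : ∀ {t u} → withPath t ~ withPath u → t ~ u
withPath-injective (node p) = singleton-~ (drop-∷ p)

withTwoLeaves≁withPath : ∀ {t u} → ¬ withTwoLeaves t ~ withPath u
withTwoLeaves≁withPath (node p) = contradiction (xs↭ys⇒|xs|≡|ys| p) λ ()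

-- Two injective ways of adding three vertices; their images are disjoint, because the root has
-- three children in one case and two in the other.
representatives-doubling : ∀ n → 2 * length (representatives n) ≤ length (representatives (3 + n))
representatives-doubling n = begin
  2 * length reps                   ≡⟨ cong (length reps +_) (+-identityʳ _) ⟩
  length reps + length reps         ≡⟨ cong₂ _+_ (length-map withTwoLeaves reps) (length-map withPath reps) ⟨
  length (map withTwoLeaves reps) + length (map withPath reps) ≡⟨ length-++ (map withTwoLeaves reps) ⟨
  length (map withTwoLeaves reps ++ map withPath reps) ≤⟨ unique-⊆⇒length-≤ ~-setoid unique ⊆ ⟩
  length (representatives (3 + n))  ∎
  where
  open ≤-Reasoning
  reps = representatives n

  unique : Unique (map withTwoLeaves reps ++ map withPath reps)
  unique = SetoidUniqueₚ.++⁺ ~-setoid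
    (SetoidUniqueₚ.map⁺ ~-setoid ~-setoid withTwoLeaves-injective (representatives-unique n))
    (SetoidUniqueₚ.map⁺ ~-setoid ~-setoid withPath-injective (representatives-unique n))
    (λ (p , q) → let _ , e = Any.satisfied (Anyₚ.map⁻ p)
                     _ , f = Any.satisfied (Anyₚ.map⁻ q)
                 in withTwoLeaves≁withPath (~-trans (~-sym e) f))

  enlarged : ∀ (f : RootedTree → RootedTree) → (∀ t → size (f t) ≡ 3 + size t) →
             ∀ {t} → t ∈ map f reps → t ∈ representatives (3 + n)
  enlarged f size-f p with SetoidMembership.find ~-setoid (Anyₚ.map⁻ p)
  ... | u , u∈ , e = ∈-resp (~-sym e)
    (∈-representatives⁺ (f u) (trans (size-f u) (cong (3 +_) (∈-representatives⁻ u∈))))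

  ⊆ : ∀ {t} → t ∈ map withTwoLeaves reps ++ map withPath reps → t ∈ representatives (3 + n)
  ⊆ p with Anyₚ.++⁻ (map withTwoLeaves reps) p
  ... | inj₁ q = enlarged withTwoLeaves (λ t → cong (3 +_) (+-identityʳ _)) q
  ... | inj₂ q = enlarged withPath (λ t → cong (3 +_) (+-identityʳ _)) q

sizes-leaves : ∀ r → sizes (replicate r leaf) ≡ r
sizes-leaves zero    = refl
sizes-leaves (suc r) = cong suc (sizes-leaves r)

-- The base case is the star with `r` leaves; each further three vertices double the count. The form
-- `suc r` excludes size zero, where no tree exists.
representatives-exponential : ∀ k r → 2 ^ k ≤ length (representatives (k * 3 + suc r))
representatives-exponential zero    r =
  nonempty (∈-representatives⁺ (node (replicate r leaf)) (cong suc (sizes-leaves r)))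
  where
  nonempty : ∀ {t} {ts : Forest} → t ∈ ts → 1 ≤ length ts
  nonempty (here _)  = z<s
  nonempty (there _) = z<s
representatives-exponential (suc k) r =
  ≤-trans (*-monoʳ-≤ 2 (representatives-exponential k r)) (representatives-doubling (k * 3 + suc r))

-- Exponential against polynomial growth

halve : ∀ n → ∃[ j ] (n ≡ j + j ⊎ n ≡ suc (j + j))
halve zero = 0 , inj₁ refl
halve (suc n) with halve n
... | j , inj₁ refl = j , inj₂ refl
... | j , inj₂ refl = suc j , inj₁ (cong suc (sym (+-suc j j)))

1+n≤2^n : ∀ n → suc n ≤ 2 ^ n
1+n≤2^n zero    = ≤-refl
1+n≤2^n (suc n) = +-mono-≤ {1} (m^n>0 2 n) (≤-trans (1+n≤2^n n) (m≤m+n _ 0))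

^-distribʳ-* : ∀ e m n → (m * n) ^ e ≡ m ^ e * n ^ e
^-distribʳ-* zero    m n = refl
^-distribʳ-* (suc e) m n = trans (cong (m * n *_) (^-distribʳ-* e m n)) (exchange m n (m ^ e) (n ^ e))
  where
  exchange : ∀ a b x y → a * b * (x * y) ≡ a * x * (b * y)
  exchange = solve-∀

-- Halving the argument turns one factor 1 + k into a power of two.
exponential-dominates : ∀ e c → ∃[ N ] ∀ k → N ≤ k → c * suc k ^ e ≤ 2 ^ k
exponential-dominates zero    c = c , λ k c≤k →
  ≤-trans (≤-reflexive (*-identityʳ c)) (≤-trans c≤k (<⇒≤ (1+n≤2^n k)))
-- With `j` the half of `k`, `suc k ≤ 2 * suc j` costs the constant `2 ^ suc e`. One `2 ^ j` covers
-- the lower power by induction, the other the remaining factor `suc j`.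
exponential-dominates (suc e) c with exponential-dominates e (c * 2 ^ suc e)
... | N , dominated = suc (N + N) , λ k N≤k → let j , k≡ = halve k in
  bound k j (double≤ j k≡) (double≥ j k≡) (dominated j (half≥ j (≤-trans N≤k (double≤′ j k≡))))
  where
  double≤ : ∀ {k} j → k ≡ j + j ⊎ k ≡ suc (j + j) → suc k ≤ 2 * suc j
  double≤ j (inj₁ refl) = s≤s (+-monoʳ-≤ j (≤-trans (n≤1+n j) (m≤m+n (suc j) 0)))
  double≤ j (inj₂ refl) = ≤-reflexive
    (cong suc (trans (sym (+-suc j j)) (cong (λ x → j + suc x) (sym (+-identityʳ j)))))

  double≤′ : ∀ {k} j → k ≡ j + j ⊎ k ≡ suc (j + j) → k ≤ suc (j + j)
  double≤′ j (inj₁ refl) = n≤1+n _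
  double≤′ j (inj₂ refl) = ≤-refl

  double≥ : ∀ {k} j → k ≡ j + j ⊎ k ≡ suc (j + j) → j + j ≤ k
  double≥ j (inj₁ refl) = ≤-refl
  double≥ j (inj₂ refl) = n≤1+n _

  half≥ : ∀ j → suc (N + N) ≤ suc (j + j) → N ≤ j
  half≥ j (s≤s p) = ≮⇒≥ λ j<N → <⇒≱ (+-mono-< j<N j<N) p

  bound : ∀ k j → suc k ≤ 2 * suc j → j + j ≤ k → c * 2 ^ suc e * suc j ^ e ≤ 2 ^ j →
          c * suc k ^ suc e ≤ 2 ^ k
  bound k j k≤ ≤k ih = begin
    c * suc k ^ suc e                     ≤⟨ *-monoʳ-≤ c (^-monoˡ-≤ (suc e) k≤) ⟩
    c * (2 * suc j) ^ suc e               ≡⟨ cong (c *_) (^-distribʳ-* (suc e) 2 (suc j)) ⟩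
    c * (2 ^ suc e * (suc j * suc j ^ e)) ≡⟨ rearrange c (2 ^ suc e) (suc j) (suc j ^ e) ⟩
    c * 2 ^ suc e * suc j ^ e * suc j     ≤⟨ *-mono-≤ ih (1+n≤2^n j) ⟩
    2 ^ j * 2 ^ j                         ≡⟨ ^-distribˡ-+-* 2 j j ⟨
    2 ^ (j + j)                           ≤⟨ ^-monoʳ-≤ 2 ≤k ⟩
    2 ^ k                                 ∎
    where
    open ≤-Reasoning
    rearrange : ∀ a b x y → a * (b * (x * y)) ≡ a * b * y * x
    rearrange = solve-∀

representatives-superpolynomial : ∀ c e → ∃[ N ] ∀ n → N ≤ n → c * (2 + n) ^ e ≤ length (representatives n)
-- For a tree size `suc n` and `k = n / 3`, the base `3 + n` is at most `3 * k + 5`, hence at most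
-- `5 * suc k`; this is the source of `5 ^ e`.
representatives-superpolynomial c e with exponential-dominates e (c * 5 ^ e)
... | N , dominated = suc (N * 3) , λ { (suc n) (s≤s N≤n) → bound n N≤n }
  where
  open ≤-Reasoning
  bound : ∀ n → N * 3 ≤ n → c * (3 + n) ^ e ≤ length (representatives (suc n))
  bound n N≤n = begin
    c * (3 + n) ^ e          ≤⟨ *-monoʳ-≤ c (^-monoˡ-≤ e 3+n≤) ⟩
    c * (5 * suc k) ^ e      ≡⟨ cong (c *_) (^-distribʳ-* e 5 (suc k)) ⟩
    c * (5 ^ e * suc k ^ e)  ≡⟨ *-assoc c (5 ^ e) (suc k ^ e) ⟨
    c * 5 ^ e * suc k ^ e    ≤⟨ dominated k (subst (_≤ k) (m*n/n≡m N 3) (/-monoˡ-≤ 3 N≤n)) ⟩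
    2 ^ k                    ≤⟨ representatives-exponential k r ⟩
    length (representatives (k * 3 + suc r))
      ≡⟨ cong (λ x → length (representatives x)) (trans (+-suc (k * 3) r) (cong suc (sym n≡))) ⟩
    length (representatives (suc n)) ∎
    where
    k = n / 3
    r = n % 3

    n≡ : n ≡ k * 3 + r
    n≡ = trans (m≡m%n+[m/n]*n n 3) (+-comm r (k * 3))

    3+n≤ : 3 + n ≤ 5 * suc k
    3+n≤ = begin
      3 + n            ≡⟨ cong (3 +_) n≡ ⟩
      3 + (k * 3 + r)  ≤⟨ +-monoʳ-≤ 3 (+-monoʳ-≤ (k * 3) (<⇒≤pred (m%n<n n 3))) ⟩
      3 + (k * 3 + 2)  ≤⟨ m≤m+n _ (2 * k) ⟩
      3 + (k * 3 + 2) + 2 * k ≡⟨ arith k ⟩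
      5 * suc k        ∎
      where
      arith : ∀ k → 3 + (k * 3 + 2) + 2 * k ≡ 5 * suc k
      arith = solve-∀

-- The proportion of trees with a given limb

-- Here `a`, `x`, `v`, `u`, `t` stand for the numbers of avoiders, sparse, diverse, repetitive and
-- all trees, `p` for the polynomial bound, and `k` for the ambiguity. Diverse trees cost `2 * t`
-- and repetitive ones `t`, so `W * a ≤ 3 * k * t`. The factor `suc (3 * k)` of `W` cancels this and
-- leaves `suc q * a ≤ t`.
strict-from-factors : ∀ k q W → W ≡ suc (3 * k) * suc q → ∀ {a x v u p t} →
  a ≤ k * x → v + u ≡ x → v * W ≤ t * 2 → u ≤ p → W * p ≤ t → 0 < p → q * a < t
strict-from-factors k q .(suc (3 * k) * suc q) refl {a} {x} {v} {u} {p} {t} a≤ refl v≤ u≤p Wp≤t 0<p =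
  drop-one a (*-cancelˡ-≤ (suc (3 * k)) (begin
    suc (3 * k) * (suc q * a)  ≡⟨ *-assoc (suc (3 * k)) (suc q) a ⟨
    W * a                      ≤⟨ *-monoʳ-≤ W a≤ ⟩
    W * (k * (v + u))          ≡⟨ rearrange W k v u ⟩
    k * (v * W + W * u)        ≤⟨ *-monoʳ-≤ k (+-mono-≤ v≤ (≤-trans (*-monoʳ-≤ W u≤p) Wp≤t)) ⟩
    k * (t * 2 + t)            ≡⟨ triple k t ⟩
    3 * k * t                  ≤⟨ *-monoˡ-≤ t (n≤1+n (3 * k)) ⟩
    suc (3 * k) * t            ∎))
  where
  open ≤-Reasoning
  W : ℕ
  W = suc (3 * k) * suc q

  rearrange : ∀ w k v u → w * (k * (v + u)) ≡ k * (v * w + w * u)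
  rearrange = solve-∀

  triple : ∀ k t → k * (t * 2 + t) ≡ 3 * k * t
  triple = solve-∀

  drop-one : ∀ a → suc q * a ≤ t → q * a < t
  -- Without avoiders, strictness requires `t` to be positive, which follows from `W * p ≤ t`.
  drop-one zero    _ = subst (_< t) (sym (*-zeroʳ q)) (≤-trans (*-mono-≤ {1} {W} z<s 0<p) Wp≤t)
  drop-one (suc a) h = ≤-trans (s≤s (m≤n+m (q * suc a) a)) h

avoiders-negligible : ∀ L q → ∃[ N ] ∀ n → N ≤ n → q * length (avoiders L n) < length (representatives n)
avoiders-negligible L q = go _ refl
  where
  l = size L
  k = ambiguity L

  module _ (W : ℕ) (W≡ : W ≡ suc (3 * k) * suc q) where
    bound : ∀ m → W * (2 + (m + l)) ^ (suc W * W) ≤ length (representatives (m + l)) →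
            suc (2 * l) < m + l → q * length (avoiders L (m + l)) < length (representatives (m + l))
    bound m large s<n = strict-from-factors k q W W≡
      (avoiders-bound L m s<n)
      (length-filter-¬ (λ t → W ≤? length (limbClasses t)) (sparse L m))
      (diverse-bound L W m)
      (≤-trans (repetitive-bound L W m) (^-monoˡ-≤ (suc W * W) (+-monoʳ-≤ 2 (m≤m+n m l))))
      large
      (m^n>0 (2 + (m + l)) (suc W * W))

    bound-∸ : ∀ n → W * (2 + n) ^ (suc W * W) ≤ length (representatives n) → suc (suc (2 * l) + l) ≤ n →
              q * length (avoiders L n) < length (representatives n)
    bound-∸ n large s<n with n ∸ l | m∸n+n≡m {n} {l} (≤-trans (m≤n+m l _) s<n)
    ... | m | refl = bound m large (≤-trans (s≤s (m≤m+n (suc (2 * l)) l)) s<n)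

    go : ∃[ N ] ∀ n → N ≤ n → q * length (avoiders L n) < length (representatives n)
    go with representatives-superpolynomial W (suc W * W)
    -- The second summand ensures that `n` splits as `m + l` and exceeds `2 * l + 1`, as shrinking
    -- requires.
    ... | N , large = N + suc (suc (2 * l) + l) , λ n N≤n →
      bound-∸ n (large n (≤-trans (m≤m+n N _) N≤n)) (≤-trans (m≤n+m _ N) N≤n)

-- The distance of `c / b` from one is `a / b`. A positive `ε` is at least one over its denominator,
-- so `↧ₙ ε * a < b` suffices; this also forces `b` to be nonzero.
close-to-1 : ∀ ε → 0ℚ ℚ.< ε → ∀ {a b c} → a + c ≡ b → ↧ₙ ε * a < b →
             Σ[ b≢0 ∈ NonZero b ] ℚ.∣ ℚ._/_ (ℤ.+ c) b {{b≢0}} ℚ.- 1ℚ ∣ ℚ.< ε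
close-to-1 ε 0<ε {a} {suc b} {c} a+c≡b small =
  _ , ℚₚ.toℚᵘ-cancel-< (ℚᵘₚ.<-respˡ-≃ (ℚᵘₚ.≃-sym distance≃) (<ε ε 0<ε small))
  where
  x : ℚᵘ
  x = mkℚᵘ (ℤ.+ c) b

  distance≃ : toℚᵘ ℚ.∣ ℚ.fromℚᵘ x ℚ.- 1ℚ ∣ ℚᵘ.≃ mkℚᵘ (ℤ.+ a) b
  distance≃ = begin
    toℚᵘ ℚ.∣ ℚ.fromℚᵘ x ℚ.- 1ℚ ∣      ≈⟨ ℚₚ.toℚᵘ-homo-∣-∣ (ℚ.fromℚᵘ x ℚ.- 1ℚ) ⟩
    ℚᵘ.∣ toℚᵘ (ℚ.fromℚᵘ x ℚ.- 1ℚ) ∣   ≈⟨ ℚᵘₚ.∣-∣-cong (ℚₚ.toℚᵘ-homo-+ (ℚ.fromℚᵘ x) (ℚ.- 1ℚ)) ⟩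
    ℚᵘ.∣ toℚᵘ (ℚ.fromℚᵘ x) ℚᵘ.- ℚᵘ.1ℚᵘ ∣ ≈⟨ ℚᵘₚ.∣-∣-cong (ℚᵘₚ.+-cong (ℚₚ.toℚᵘ-fromℚᵘ x) ℚᵘₚ.≃-refl) ⟩
    ℚᵘ.∣ x ℚᵘ.- ℚᵘ.1ℚᵘ ∣             ≈⟨ *≡* (cong₂ (λ u v → ℤ.+ u ℤ.* ℤ.+ v) numerator (sym (*-identityʳ (suc b)))) ⟩
    mkℚᵘ (ℤ.+ a) b                     ∎
    where
    open ℚᵘₚ.≃-Reasoning
    numerator : ℤ.∣ ℤ.+ c ℤ.* ℤ.+ 1 ℤ.+ (ℤ.- ℤ.+ 1) ℤ.* ℤ.+ suc b ∣ ≡ a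
    numerator = trans (cong₂ (λ u v → ℤ.∣ u ℤ.+ v ∣) (ℤₚ.*-identityʳ (ℤ.+ c)) (ℤₚ.-1*i≡-i (ℤ.+ suc b)))
      (trans (cong ℤ.∣_∣ (ℤₚ.m-n≡m⊖n c (suc b)))
        (trans (ℤₚ.∣⊖∣-≤ (≤-trans (m≤n+m c a) (≤-reflexive a+c≡b)))
          (trans (cong (_∸ c) (sym a+c≡b)) (m+n∸n≡m a c))))

  <ε : ∀ ε → 0ℚ ℚ.< ε → ↧ₙ ε * a < suc b → mkℚᵘ (ℤ.+ a) b ℚᵘ.< toℚᵘ ε
  <ε (mkℚ (ℤ.+ zero)   d _) 0<ε small = contradiction (ℚₚ.drop-*<* 0<ε) (ℤₚ.<-irrefl refl)
  <ε (mkℚ +[1+ p ]   d _) 0<ε small = *<* (subst₂ ℤ._<_ (ℤₚ.pos-* a (suc d)) (ℤₚ.pos-* (suc p) (suc b))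
    (ℤ.+<+ (≤-trans (≤-trans (s≤s (≤-reflexive (*-comm a (suc d)))) small) (m≤m+n (suc b) (p * suc b)))))
  <ε (mkℚ -[1+ p ]   d _) 0<ε small = contradiction (ℚₚ.drop-*<* 0<ε) λ ()

mainTheorem5 : (L : RootedTree) →
    Σ[ total ∈ (ℕ → ℕ) ] Σ[ withL ∈ (ℕ → ℕ) ]
    (∀ n → CountUpToIso (λ t → size t ≡ n) (total n)) ×
    (∀ n → CountUpToIso (λ t → size t ≡ n × HasMaximalLimb L t) (withL n)) ×
    QuotientTendsTo withL total 1ℚ
mainTheorem5 L = length ∘ representatives , length ∘ containers ,
  (λ n → countUpToIso (representatives-unique n)
    (λ i → ∈-representatives⁻ {n} (SetoidMembershipₚ.∈-lookup ~-setoid (representatives n) i))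
    ∈-representatives⁺) ,
  (λ n → countUpToIso (SetoidUniqueₚ.filter⁺ ~-setoid contains? (representatives-unique n))
    (λ i → ∈-containers⁻ {n} (SetoidMembershipₚ.∈-lookup ~-setoid (containers n) i))
    (λ t (size-t , hasL) → SetoidMembershipₚ.∈-filter⁺ ~-setoid contains? contains-resp
       (∈-representatives⁺ t size-t) (>⇒≢ (limb⇒occ hasL)))) ,
  -- The multiplier `q` is the denominator of `ε`; avoiders and containers together make up all
  -- representatives.
  λ ε 0<ε → let N , small = avoiders-negligible L (↧ₙ ε) in
    N , λ n N≤n → close-to-1 ε 0<ε (length-filter-¬ (λ t → occ L t ≟ 0) (representatives n)) (small n N≤n)
  where
  contains? : ∀ t → Dec (¬ occ L t ≡ 0)
  contains? t = ¬? (occ L t ≟ 0)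

  containers : ℕ → List RootedTree
  containers n = filter contains? (representatives n)

  contains-resp : ∀ {t u} → t ~ u → ¬ occ L t ≡ 0 → ¬ occ L u ≡ 0
  contains-resp e = subst (λ k → ¬ k ≡ 0) (occ-resp-~ L e)

  ∈-containers⁻ : ∀ {n t} → t ∈ containers n → size t ≡ n × HasMaximalLimb L t
  ∈-containers⁻ {n} {t} t∈ =
    let t∈reps , occurs = SetoidMembershipₚ.∈-filter⁻ ~-setoid contains? contains-resp {xs = representatives n} t∈
    in ∈-representatives⁻ t∈reps , occ⇒limb t (n≢0⇒n>0 occurs)
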